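{- Let $p$ and $q$ be two distinct odd primes and let $\delta$ be a positive divisor of $\lambda(pq)$. Then $$\sum_{\substack{a\in U_{pq}\\ \mathrm{ind}_{pq}(a)=\delta}} a\equiv \mu\big((\delta,p-1)\big)\, I\!\left(\Big(\frac{\delta}{(\delta,p-1)},\,p-1\Big)\right)\frac{\phi(\delta)}{\phi\big((\delta,p-1)\big)}\pmod p.$$
   Context: $U_m$ denotes the set of invertible elements of $\mathbb{Z}/m\mathbb{Z}$. For $a\in U_m$, $\mathrm{ind}_m(a)$ is the smallest positive integer $k$ with $a^k\equiv 1\pmod m$ (the multiplicative order of $a$). $\lambda(m)$ is the Carmichael function: the least $k>0$ such that $a^k\equiv1\pmod m$ for all $a\in U_m$. $\mu$ is the Möbius function, $\phi$ Euler's totient function, $(x,y)$ the gcd, and $I(n)=\lfloor 1/n\rfloor$ for positive integers $n$ (so $I(1)=1$ and $I(n)=0$ for $n>1$). -}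

module Defs where

open import Data.Nat using (ℕ; zero; suc; _+_; _*_; _∸_; _^_; _<_; _≟_; _/_; _%_)
open import Data.Nat.Divisibility using (_∣_; _∣?_)
open import Data.Nat.Coprimality using (Coprime; coprime?)
open import Data.Nat.GCD using (gcd)
open import Data.Integer as ℤ using (ℤ; +_)
open import Data.List using (List; []; _∷_; map; filter; length; upTo)
open import Data.Nat.ListAction using (sum)
open import Data.Product using (_×_)
open import Relation.Nullary using (¬_; yes; no)
open import Relation.Nullary.Decidable using (⌊_⌋)
open import Relation.Binary.PropositionalEquality using (_≡_)

modN : ℕ → ℕ → ℕ
modN x zero    = x
modN x (suc m) = x % suc m

_≡_[mod_] : ℕ → ℕ → ℕ → Set
x ≡ y [mod m ] = modN x m ≡ modN y m

range : ℕ → ℕ → List ℕ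
range lo n = map (λ i → lo + i) (upTo n)

units : ℕ → List ℕ
units m = filter (λ a → coprime? a m) (upTo m)

firstHit : List ℕ → (ℕ → ℕ) → ℕ → ℕ
firstHit []       f t = 0
firstHit (k ∷ ks) f t with f k ≟ t
... | yes _ = k
... | no  _ = firstHit ks f t

-- ind_m(a): the least positive k with a^k ≡ 1 (mod m).  For a ∈ U_m the order
-- is at most φ(m) ≤ m, so searching k ∈ {1,…,m} finds it.
ind : ℕ → ℕ → ℕ
ind m a = firstHit (range 1 m) (λ k → modN (a ^ k) m) (modN 1 m)

AllUnitsPow1 : ℕ → ℕ → Set
AllUnitsPow1 m k = ∀ a → a < m → Coprime a m → (a ^ k) ≡ 1 [mod m ]

IsCarmichael : ℕ → ℕ → Set
IsCarmichael m L = (0 < L) × AllUnitsPow1 m L × (∀ k → 0 < k → k < L → ¬ AllUnitsPow1 m k)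

φ : ℕ → ℕ
φ n = length (filter (λ k → coprime? k n) (range 1 n))

leastDiv : ℕ → ℕ
leastDiv n = firstHit (range 2 n) (λ d → modN n d) 0

-- Möbius function on positive integers:
-- μ(1) = 1; if the least prime p of n has p² ∣ n then 0, else μ(n) = -μ(n/p).
-- The fuel argument (= n) bounds the number of prime factors.
μ-fuel : ℕ → ℕ → ℤ
μ-fuel zero    n = + 0
μ-fuel (suc f) n with n ≟ 1
... | yes _ = + 1
... | no  _ with leastDiv n
...   | zero  = + 0
...   | suc d with (suc d * suc d) ∣? n
...     | yes _ = + 0
...     | no  _ = ℤ.- μ-fuel f (n / suc d)

μ : ℕ → ℤ
μ n = μ-fuel n n

-- I(n) = ⌊1/n⌋ for n ≥ 1
I : ℕ → ℕ
I (suc zero) = 1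
I _          = 0

-- exact division (divisor 0 mapped to 0; only used with positive divisors)
_div_ : ℕ → ℕ → ℕ
m div zero    = 0
m div (suc n) = m / suc n

sumOrd : ℕ → ℕ → ℕ
sumOrd m δ = sum (filter (λ a → ind m a ≟ δ) (units m))

{-# OPTIONS --safe #-}

-- Induct on δ, more generally for divisors δ of (p − 1)(q − 1), and put g = (δ, p − 1).
--
-- If g = 1, every element of order δ is ≡ 1 (mod p). Since δ ∣ q − 1, the elements of order δ are the
-- powers yᵏ, k ≤ δ prime to δ, of a single one, so the sum is ≡ φ(δ).
--
-- Otherwise let r be a prime factor of g and δ = r d. Some c with c ^ r = 1 in U_pq satisfies c ≢ 1 (mod p).
-- The set of x for which x ^ r has order d is stable under multiplication by c, so its sum is ≡ 0 (mod p).
-- If r ∣ d this set consists of the elements of order δ, and the right-hand side vanishes as well.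
-- If r ∤ d it consists of the elements of order δ or d, and passing from d to δ changes the sign of the
-- right-hand side: μ contributes −1, and both totients are multiplied by r − 1.

module Submission where

open import Defs
open import Data.Nat as ℕ
  using (ℕ; zero; suc; _+_; _*_; _∸_; _^_; _≤_; _<_; z≤n; s≤s; NonZero; _≟_; _%_; _/_)
open import Data.Nat.Properties as ℕₚ
  using (≤-refl; ≤-trans; <-≤-trans; ≤-<-trans; m≤m+n; m≤n+m; *-comm; *-assoc; *-identityʳ; +-comm)
open import Data.Nat.Divisibility as Div
  using (_∣_; divides; _∣?_; ∣-trans; ∣-refl; ∣-antisym; 1∣_; _∣0; n∣m*n; m∣m*n)
import Data.Nat.DivMod as DM
open import Data.Nat.Induction using (<-rec)
open import Data.Nat.Coprimality as Cop using (Coprime; coprime?)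
open import Data.Nat.GCD as GCD using (gcd)
open import Data.Nat.Primality
  using (Prime; prime; euclidsLemma; prime⇒nonZero; prime⇒nonTrivial; prime⇒irreducible)
open import Data.Nat.ListAction using (sum; product)
open import Data.Nat.ListAction.Properties using (sum-↭; product-↭; sum-++)
open import Data.Integer as ℤ using (ℤ; +_; -_; _-_; 0ℤ; 1ℤ; ∣_∣)
  renaming (_+_ to _+ᶻ_; _*_ to _*ᶻ_; _^_ to _^ᶻ_)
import Data.Integer.Properties as ℤₚ
import Data.Integer.DivMod as ℤD
open import Data.Integer.Divisibility using () renaming (_∣_ to _∣ℤ_)
open import Data.Integer.Divisibility.Signed as Signed using (∣ᵤ⇒∣; ∣⇒∣ᵤ)
open import Data.Integer.Tactic.RingSolver using (solve-∀)
open import Data.List using (List; []; _∷_; _++_; map; filter; length; upTo)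
import Data.List.Properties as Listₚ
open import Data.List.Membership.Propositional using (_∈_; find)
open import Data.List.Membership.Propositional.Properties
  using (∈-map⁺; ∈-map⁻; ∈-filter⁺; ∈-filter⁻; ∈-upTo⁺; ∈-upTo⁻; ∈-++⁺ˡ; ∈-++⁺ʳ; ∈-++⁻)
open import Data.List.Membership.Propositional.Properties.WithK using (unique∧set⇒bag)
open import Data.List.Relation.Binary.BagAndSetEquality using (∼bag⇒↭)
open import Data.List.Relation.Binary.Permutation.Propositional using (_↭_)
open import Data.List.Relation.Binary.Permutation.Propositional.Properties using (↭-length)
open import Data.List.Relation.Unary.Any as Any using (here; there)
open import Data.List.Relation.Unary.All as All using (All; []; _∷_)
open import Data.List.Relation.Unary.All.Properties as Allₚ using (¬All⇒Any¬; ¬Any⇒All¬)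
open import Data.List.Relation.Unary.AllPairs using (AllPairs; []; _∷_)
import Data.List.Relation.Unary.AllPairs.Properties as AllPairsₚ
open import Data.List.Relation.Unary.Unique.Propositional using (Unique)
import Data.List.Relation.Unary.Unique.Propositional.Properties as Uniqueₚ
open import Data.Vec using (Vec; []; _∷_; replicate)
open import Data.Product using (_×_; _,_; proj₁; proj₂; ∃-syntax)
open import Data.Sum using (_⊎_; inj₁; inj₂; [_,_]′)
open import Function using (_∘_; id)
open import Function.Bundles using (mk⇔)
open import Relation.Nullary using (¬_; Dec; yes; no; contradiction)
open import Relation.Binary.PropositionalEquality using (_≡_; _≢_; refl; sym; trans; cong; cong₂; subst)

-- Congruences between integers

infix 4 _≋_[_]

-- As a record, the relation lets unification recover both sides and the modulus; bare divisibility
-- of `x - y` would expose the subtraction to unfolding.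
record _≋_[_] (x y : ℤ) (m : ℕ) : Set where
  constructor ≋-mk
  field diff : (+ m) Signed.∣ (x - y)
open _≋_[_]

≋-reflexive : ∀ {m x y} → x ≡ y → x ≋ y [ m ]
≋-reflexive {x = x} refl = ≋-mk (Signed.divides 0ℤ (ℤₚ.+-inverseʳ x))

≋-refl : ∀ {m x} → x ≋ x [ m ]
≋-refl = ≋-reflexive refl

≋-sym : ∀ {m x y} → x ≋ y [ m ] → y ≋ x [ m ]
≋-sym {m} {x} {y} (≋-mk d) = ≋-mk (subst ((+ m) Signed.∣_) (eq x y) (Signed.∣m⇒∣-m d))
  where eq : ∀ x y → - (x - y) ≡ y - x
        eq = solve-∀

≋-trans : ∀ {m x y z} → x ≋ y [ m ] → y ≋ z [ m ] → x ≋ z [ m ]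
≋-trans {m} {x} {y} {z} (≋-mk d) (≋-mk e) = ≋-mk (subst ((+ m) Signed.∣_) (eq x y z) (Signed.∣m∣n⇒∣m+n d e))
  where eq : ∀ x y z → (x - y) +ᶻ (y - z) ≡ x - z
        eq = solve-∀

≋-+ : ∀ {m x y z w} → x ≋ y [ m ] → z ≋ w [ m ] → x +ᶻ z ≋ y +ᶻ w [ m ]
≋-+ {m} {x} {y} {z} {w} (≋-mk d) (≋-mk e) = ≋-mk (subst ((+ m) Signed.∣_) (eq x y z w) (Signed.∣m∣n⇒∣m+n d e))
  where eq : ∀ x y z w → (x - y) +ᶻ (z - w) ≡ (x +ᶻ z) - (y +ᶻ w)
        eq = solve-∀

≋-* : ∀ {m x y z w} → x ≋ y [ m ] → z ≋ w [ m ] → x *ᶻ z ≋ y *ᶻ w [ m ]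
≋-* {m} {x} {y} {z} {w} (≋-mk d) (≋-mk e) = ≋-mk (subst ((+ m) Signed.∣_) (eq x y z w)
    (Signed.∣m∣n⇒∣m+n (Signed.∣n⇒∣m*n z d) (Signed.∣n⇒∣m*n y e)))
  where eq : ∀ x y z w → z *ᶻ (x - y) +ᶻ y *ᶻ (z - w) ≡ x *ᶻ z - y *ᶻ w
        eq = solve-∀

≋-*ˡ : ∀ {m} c {x y} → x ≋ y [ m ] → c *ᶻ x ≋ c *ᶻ y [ m ]
≋-*ˡ c {x} {y} e = ≋-* {x = c} {c} {x} {y} ≋-refl e

≋-*ʳ : ∀ {m} c {x y} → x ≋ y [ m ] → x *ᶻ c ≋ y *ᶻ c [ m ]
≋-*ʳ c {x} {y} e = ≋-* {x = x} {y} {c} {c} e ≋-refl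

≋-^ : ∀ {m x y} n → x ≋ y [ m ] → x ^ᶻ n ≋ y ^ᶻ n [ m ]
≋-^ zero    e = ≋-refl
≋-^ (suc n) e = ≋-* e (≋-^ n e)

≋-weaken : ∀ {d m x y} → d ∣ m → x ≋ y [ m ] → x ≋ y [ d ]
≋-weaken d∣m (≋-mk e) = ≋-mk (Signed.∣-trans (∣ᵤ⇒∣ d∣m) e)

≋? : ∀ x y m → Dec (x ≋ y [ m ])
≋? x y m with (+ m) Signed.∣? (x - y)
... | yes d = yes (≋-mk d)
... | no ¬d = no λ e → ¬d (diff e)

≋0 : ∀ {m x} → (+ m) Signed.∣ x → x ≋ 0ℤ [ m ]
≋0 {m} {x} d = ≋-mk (subst ((+ m) Signed.∣_) (sym (ℤₚ.+-identityʳ x)) d)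

≋0⁻¹ : ∀ {m x} → x ≋ 0ℤ [ m ] → (+ m) Signed.∣ x
≋0⁻¹ {m} {x} (≋-mk d) = subst ((+ m) Signed.∣_) (ℤₚ.+-identityʳ x) d

≋-difference : ∀ {m x y} → x - y ≋ 0ℤ [ m ] → x ≋ y [ m ]
≋-difference e = ≋-mk (≋0⁻¹ e)

≋-%ℕ : ∀ z m .{{_ : NonZero m}} → + (z ℤD.%ℕ m) ≋ z [ m ]
≋-%ℕ z m = ≋-sym (≋-mk (Signed.divides (z ℤD./ℕ m) (trans (cong (_- r) (ℤD.a≡a%ℕn+[a/ℕn]*n z m)) (eq r _))))
  where r = + (z ℤD.%ℕ m)
        eq : ∀ r s → r +ᶻ s - r ≡ s
        eq = solve-∀

<∧∣⇒≡0 : ∀ {m k} → k < m → m ∣ k → k ≡ 0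
<∧∣⇒≡0 {k = zero}  _   _   = refl
<∧∣⇒≡0 {k = suc _} k<m m∣k = contradiction (Div.∣⇒≤ m∣k) (ℕₚ.<⇒≱ k<m)

-- The distance between two numbers below `m` is below `m`, so it can be a multiple of `m` only by
-- being zero.
≋-injective : ∀ {m x y} → x < m → y < m → + x ≋ + y [ m ] → x ≡ y
≋-injective {m} {x} {y} x<m y<m (≋-mk d) with x ℕ.≤? y | ∣⇒∣ᵤ d
... | yes x≤y | e = ℕₚ.≤-antisym x≤y (ℕₚ.m∸n≡0⇒m≤n (<∧∣⇒≡0 (≤-<-trans (ℕₚ.m∸n≤m y x) y<m)
                      (subst (m ∣_) (trans (cong ∣_∣ (ℤₚ.m-n≡m⊖n x y)) (ℤₚ.∣⊖∣-≤ x≤y)) e)))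
... | no x≰y | e = ℕₚ.≤-antisym (ℕₚ.m∸n≡0⇒m≤n (<∧∣⇒≡0 (≤-<-trans (ℕₚ.m∸n≤m x y) x<m)
                      (subst (m ∣_) (trans (cong ∣_∣ (ℤₚ.m-n≡m⊖n x y)) (trans (ℤₚ.∣m⊖n∣≡∣n⊖m∣ x y) (ℤₚ.∣⊖∣-≤ y≤x))) e))) y≤x
  where y≤x = ℕₚ.<⇒≤ (ℕₚ.≰⇒> x≰y)

modN≡⇒≋ : ∀ {x y} m .{{_ : NonZero m}} → modN x m ≡ modN y m → + x ≋ + y [ m ]
modN≡⇒≋ {x} {y} m@(suc _) e =
  ≋-trans (≋-sym (≋-%ℕ (+ x) m)) (≋-trans (≋-reflexive (cong +_ e)) (≋-%ℕ (+ y) m))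

≋⇒modN≡ : ∀ {x y} m .{{_ : NonZero m}} → + x ≋ + y [ m ] → modN x m ≡ modN y m
≋⇒modN≡ {x} {y} m@(suc _) e = ≋-injective (DM.m%n<n x m) (DM.m%n<n y m)
  (≋-trans (≋-%ℕ (+ x) m) (≋-trans e (≋-sym (≋-%ℕ (+ y) m))))

≋-prime-factor : ∀ {p} → Prime p → ∀ x y → x *ᶻ y ≋ 0ℤ [ p ] → x ≋ 0ℤ [ p ] ⊎ y ≋ 0ℤ [ p ]
≋-prime-factor {p} pp x y e with euclidsLemma ∣ x ∣ ∣ y ∣ pp (subst (p ∣_) (ℤₚ.abs-* x y) (∣⇒∣ᵤ (≋0⁻¹ e)))
... | inj₁ d = inj₁ (≋0 (∣ᵤ⇒∣ d))
... | inj₂ d = inj₂ (≋0 (∣ᵤ⇒∣ d))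

coprime-product-∣ : ∀ {m n k} → Coprime m n → m ∣ k → n ∣ k → m * n ∣ k
coprime-product-∣ {m} {n} c (divides a refl) n∣am =
  subst (m * n ∣_) (*-comm m a) (Div.*-monoʳ-∣ m (Cop.coprime-divisor (Cop.sym c) (subst (n ∣_) (*-comm a m) n∣am)))

≋-coprime-product : ∀ {m n x y} → Coprime m n → x ≋ y [ m ] → x ≋ y [ n ] → x ≋ y [ m * n ]
≋-coprime-product c (≋-mk d) (≋-mk e) = ≋-mk (∣ᵤ⇒∣ (coprime-product-∣ c (∣⇒∣ᵤ d) (∣⇒∣ᵤ e)))

pos-^ : ∀ a n → + (a ^ n) ≡ (+ a) ^ᶻ n
pos-^ a zero    = refl
pos-^ a (suc n) = trans (ℤₚ.pos-* a (a ^ n)) (cong ((+ a) *ᶻ_) (pos-^ a n))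

≋-inverse : ∀ {a m} → Coprime a m → ∃[ u ] u *ᶻ (+ a) ≋ 1ℤ [ m ]
≋-inverse {a} {m} c with Cop.coprime-Bézout c
... | GCD.Bézout.+- x y eq = + x , ≋-mk (Signed.divides (+ y) (trans (cong (_- 1ℤ)
        (trans (sym (ℤₚ.pos-* x a)) (trans (cong +_ (sym eq)) (cong (1ℤ +ᶻ_) (ℤₚ.pos-* y m))))) (lem ((+ y) *ᶻ (+ m)))))
  where lem : ∀ z → (1ℤ +ᶻ z) - 1ℤ ≡ z
        lem = solve-∀
... | GCD.Bézout.-+ x y eq = - (+ x) , ≋-mk (Signed.divides (- (+ y)) (trans (lem (+ x) (+ a))
        (trans (cong -_ (trans (cong (1ℤ +ᶻ_) (sym (ℤₚ.pos-* x a))) (trans (cong +_ eq) (ℤₚ.pos-* y m)))) (ℤₚ.neg-distribˡ-* (+ y) (+ m)))))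
  where lem : ∀ x a → (- x) *ᶻ a - 1ℤ ≡ - (1ℤ +ᶻ x *ᶻ a)
        lem = solve-∀

crt : ∀ {m n} → Coprime m n → ∀ x y → ∃[ z ] (z ≋ x [ m ] × z ≋ y [ n ])
crt {m} {n} c x y with ≋-inverse c
-- `v` is a multiple of `m` and is 1 modulo `n`, so it selects `y` modulo `n`, while `1ℤ - v`
-- selects `x` modulo `m`.
... | u , ≋-mk e = y *ᶻ v +ᶻ x *ᶻ (1ℤ - v)
        , ≋-mk (Signed.divides ((y - x) *ᶻ u) (lem₁ x y u (+ m)))
        , ≋-mk (subst ((+ n) Signed.∣_) (lem₂ x y v) (Signed.∣n⇒∣m*n (y - x) e))
  where v = u *ᶻ (+ m)
        lem₁ : ∀ x y u m → y *ᶻ (u *ᶻ m) +ᶻ x *ᶻ (1ℤ - u *ᶻ m) - x ≡ (y - x) *ᶻ u *ᶻ m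
        lem₁ = solve-∀
        lem₂ : ∀ x y v → (y - x) *ᶻ (v - 1ℤ) ≡ y *ᶻ v +ᶻ x *ᶻ (1ℤ - v) - y
        lem₂ = solve-∀

-- Multiplicative orders

-- The order is given by divisibility instead of minimality, so uniqueness is antisymmetry of `∣`.
-- The value `d = 0` is allowed and says that no positive power is 1; hence the hypotheses `0 < d`
-- below.
record HasOrd (m : ℕ) (x : ℤ) (d : ℕ) : Set where
  constructor hasOrd
  field
    power   : x ^ᶻ d ≋ 1ℤ [ m ]
    divisor : ∀ n → x ^ᶻ n ≋ 1ℤ [ m ] → d ∣ n
open HasOrd

pow-* : ∀ {m} x a b → x ^ᶻ a ≋ 1ℤ [ m ] → x ^ᶻ (a * b) ≋ 1ℤ [ m ]
pow-* {m} x a b e = ≋-trans (≋-reflexive (sym (ℤₚ.^-*-assoc x a b)))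
  (≋-trans (≋-^ b e) (≋-reflexive (ℤₚ.^-zeroˡ b)))

pow-∣ : ∀ {m} x a {n} → x ^ᶻ a ≋ 1ℤ [ m ] → a ∣ n → x ^ᶻ n ≋ 1ℤ [ m ]
pow-∣ {m} x a e (divides k refl) = subst (λ n → x ^ᶻ n ≋ 1ℤ [ m ]) (*-comm a k) (pow-* x a k e)

pow-cancel : ∀ {m} x a b → x ^ᶻ (a + b) ≋ 1ℤ [ m ] → x ^ᶻ a ≋ 1ℤ [ m ] → x ^ᶻ b ≋ 1ℤ [ m ]
pow-cancel x a b e f = ≋-trans (≋-reflexive (sym (ℤₚ.*-identityˡ _)))
  (≋-trans (≋-* (≋-sym f) ≋-refl) (≋-trans (≋-reflexive (sym (ℤₚ.^-distribˡ-+-* x a b))) e))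

-- By Bézout a multiple of one exponent exceeds a multiple of the other by 1, and cancelling the
-- smaller power leaves `x` itself. The two cases are the two signs of the identity over the
-- naturals.
pow-coprime : ∀ {m} x a b → Coprime a b → x ^ᶻ a ≋ 1ℤ [ m ] → x ^ᶻ b ≋ 1ℤ [ m ] → x ≋ 1ℤ [ m ]
pow-coprime {m} x a b c ea eb = subst (_≋ 1ℤ [ m ]) (ℤₚ.^-identityʳ x) one
  where
  one : x ^ᶻ 1 ≋ 1ℤ [ m ]
  one with Cop.coprime-Bézout c
  ... | GCD.Bézout.+- u v eq = pow-cancel x (v * b) 1
          (subst (λ n → x ^ᶻ n ≋ 1ℤ [ m ]) (trans (sym eq) (+-comm 1 (v * b))) (pow-∣ x a ea (n∣m*n u))) (pow-∣ x b eb (n∣m*n v))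
  ... | GCD.Bézout.-+ u v eq = pow-cancel x (u * a) 1
          (subst (λ n → x ^ᶻ n ≋ 1ℤ [ m ]) (trans (sym eq) (+-comm 1 (u * a))) (pow-∣ x b eb (n∣m*n v))) (pow-∣ x a ea (n∣m*n u))

hasOrd-unique : ∀ {m x d e} → HasOrd m x d → HasOrd m x e → d ≡ e
hasOrd-unique o o′ = ∣-antisym (divisor o _ (power o′)) (divisor o′ _ (power o))

hasOrd-≋ : ∀ {m x y d} → x ≋ y [ m ] → HasOrd m x d → HasOrd m y d
hasOrd-≋ {d = d} e (hasOrd p q) = hasOrd (≋-trans (≋-^ d (≋-sym e)) p) (λ n f → q n (≋-trans (≋-^ n e) f))

-- Division with remainder: if `n` is an exponent of `x`, so is `n % d`, which lies below `d` and is
-- therefore zero.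
hasOrd-least : ∀ {m x d} → 0 < d → x ^ᶻ d ≋ 1ℤ [ m ] →
               (∀ k → 0 < k → k < d → ¬ x ^ᶻ k ≋ 1ℤ [ m ]) → HasOrd m x d
hasOrd-least {m} {x} {d@(suc _)} _ p least = hasOrd p λ n e →
  Div.m%n≡0⇒n∣m n d (rem-zero (n % d) (DM.m%n<n n d)
    (pow-cancel x (n / d * d) (n % d)
      (subst (λ n → x ^ᶻ n ≋ 1ℤ [ m ]) (trans (DM.m≡m%n+[m/n]*n n d) (+-comm (n % d) _)) e)
      (pow-∣ x d p (n∣m*n (n / d)))))
  where
  rem-zero : ∀ r → r < d → x ^ᶻ r ≋ 1ℤ [ m ] → r ≡ 0
  rem-zero zero    _   _ = refl
  rem-zero (suc r) r<d e = contradiction e (least (suc r) (s≤s z≤n) r<d)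

-- Rearranging lists of residues

unique⇒↭ : ∀ {xs ys : List ℕ} → Unique xs → Unique ys →
           (∀ {x} → x ∈ xs → x ∈ ys) → (∀ {x} → x ∈ ys → x ∈ xs) → xs ↭ ys
unique⇒↭ u v f g = ∼bag⇒↭ (unique∧set⇒bag u v (mk⇔ f g))

-- The left inverse is required on members of `xs` only, because scaling is injective on reduced
-- residues and not on all of `ℕ`.
unique-map : ∀ {xs : List ℕ} (f g : ℕ → ℕ) → (∀ {x} → x ∈ xs → g (f x) ≡ x) →
             Unique xs → Unique (map f xs)
unique-map {xs} f g inv u = Uniqueₚ.map⁻ {f = g} (subst Unique
  (sym (trans (sym (Listₚ.map-∘ xs)) (Listₚ.map-id-local (All.tabulate inv)))) u)

∈-range⁺ : ∀ {lo n k} → lo ≤ k → k < lo + n → k ∈ range lo n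
∈-range⁺ {lo} {n} {k} lo≤k k<lo+n = subst (_∈ range lo n) (ℕₚ.m+[n∸m]≡n lo≤k)
  (∈-map⁺ (λ i → lo + i) (∈-upTo⁺ (ℕₚ.+-cancelˡ-< lo _ _ (subst (_< lo + n) (sym (ℕₚ.m+[n∸m]≡n lo≤k)) k<lo+n))))

∈-range⁻ : ∀ {lo n k} → k ∈ range lo n → lo ≤ k × k < lo + n
∈-range⁻ {lo} k∈ with ∈-map⁻ (λ i → lo + i) k∈
... | i , i∈ , refl = m≤m+n lo i , ℕₚ.+-monoʳ-< lo (∈-upTo⁻ i∈)

unique-range : ∀ lo n → Unique (range lo n)
unique-range lo n = Uniqueₚ.map⁺ (ℕₚ.+-cancelˡ-≡ lo _ _) (Uniqueₚ.upTo⁺ n)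

length-range : ∀ lo n → length (range lo n) ≡ n
length-range lo n = trans (Listₚ.length-map (λ i → lo + i) (upTo n)) (Listₚ.length-upTo n)

sum-map-≋ : ∀ {m} c (f : ℕ → ℕ) xs → (∀ {x} → x ∈ xs → + f x ≋ c *ᶻ + x [ m ]) →
            + sum (map f xs) ≋ c *ᶻ + sum xs [ m ]
sum-map-≋ c f []       _ = ≋-reflexive (sym (ℤₚ.*-zeroʳ c))
sum-map-≋ c f (x ∷ xs) e = ≋-trans (≋-reflexive (ℤₚ.pos-+ (f x) _))
  (≋-trans (≋-+ (e (here refl)) (sum-map-≋ c f xs (e ∘ there)))
    (≋-reflexive (trans (sym (ℤₚ.*-distribˡ-+ c (+ x) (+ sum xs))) (cong (c *ᶻ_) (sym (ℤₚ.pos-+ x (sum xs)))))))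

product-map-≋ : ∀ {m} c (f : ℕ → ℕ) xs → (∀ {x} → x ∈ xs → + f x ≋ c *ᶻ + x [ m ]) →
                + product (map f xs) ≋ c ^ᶻ length xs *ᶻ + product xs [ m ]
product-map-≋ c f []       _ = ≋-refl
product-map-≋ c f (x ∷ xs) e = ≋-trans (≋-reflexive (ℤₚ.pos-* (f x) _))
  (≋-trans (≋-* (e (here refl)) (product-map-≋ c f xs (e ∘ there)))
    (≋-reflexive (trans (lem c (+ x) (c ^ᶻ length xs) (+ product xs))
                        (cong (c ^ᶻ suc (length xs) *ᶻ_) (sym (ℤₚ.pos-* x (product xs)))))))
  where lem : ∀ c x d y → c *ᶻ x *ᶻ (d *ᶻ y) ≡ c *ᶻ d *ᶻ (x *ᶻ y)
        lem = solve-∀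

-- Opaque because unification otherwise unfolds the integer product under _%ℕ_ and cannot recover its factors.
opaque
  scale : (m : ℕ) .{{_ : NonZero m}} → ℤ → ℕ → ℕ
  scale m c x = (c *ᶻ + x) ℤD.%ℕ m

  scale-< : ∀ m .{{_ : NonZero m}} c x → scale m c x < m
  scale-< m c x = ℤD.n%ℕd<d (c *ᶻ + x) m

  scale-≋ : ∀ m .{{_ : NonZero m}} c x → + scale m c x ≋ c *ᶻ + x [ m ]
  scale-≋ m c x = ≋-%ℕ (c *ᶻ + x) m

scale-inverse : ∀ m .{{_ : NonZero m}} c d {x} → c *ᶻ d ≋ 1ℤ [ m ] → x < m → scale m c (scale m d x) ≡ x
scale-inverse m c d {x} cd x<m = ≋-injective (scale-< m c _) x<m
  (≋-trans (scale-≋ m c _) (≋-trans (≋-*ˡ c (scale-≋ m d x))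
  (≋-trans (≋-reflexive (sym (ℤₚ.*-assoc c d (+ x))))
  (≋-trans (≋-*ʳ (+ x) cd) (≋-reflexive (ℤₚ.*-identityˡ (+ x)))))))

-- Multiplication by `c` is undone by multiplication by `d`, so closure under both makes it a
-- bijection of the listed set.
scale-↭ : ∀ {m} .{{_ : NonZero m}} c d {xs} → c *ᶻ d ≋ 1ℤ [ m ] → Unique xs → (∀ {x} → x ∈ xs → x < m) →
          (∀ {x} → x ∈ xs → scale m c x ∈ xs) → (∀ {x} → x ∈ xs → scale m d x ∈ xs) →
          map (scale m c) xs ↭ xs
scale-↭ {m} c d {xs} cd u bound c∈ d∈ =
  unique⇒↭ (unique-map (scale m c) (scale m d)
      (λ x∈ → scale-inverse m d c (≋-trans (≋-reflexive (ℤₚ.*-comm d c)) cd) (bound x∈)) u) u to from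
  where
  to : ∀ {x} → x ∈ map (scale m c) xs → x ∈ xs
  to y∈ with ∈-map⁻ (scale m c) y∈
  ... | x , x∈ , refl = c∈ x∈
  from : ∀ {x} → x ∈ xs → x ∈ map (scale m c) xs
  from x∈ = subst (_∈ map (scale m c) xs) (scale-inverse m c d cd (bound x∈)) (∈-map⁺ (scale m c) (d∈ x∈))

-- Arithmetic modulo a prime and Fermat's theorem

prime⇒1< : ∀ {p} → Prime p → 1 < p
prime⇒1< pp = ℕ.nonTrivial⇒n>1 _ {{prime⇒nonTrivial pp}}

prime⇒≉0 : ∀ {p} → Prime p → ¬ 1ℤ ≋ 0ℤ [ p ]
prime⇒≉0 pp e with ≋-injective (prime⇒1< pp) (ℕₚ.<-trans (s≤s z≤n) (prime⇒1< pp)) e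
... | ()

≋-cancelʳ : ∀ {p} → Prime p → ∀ x y z → ¬ z ≋ 0ℤ [ p ] → x *ᶻ z ≋ y *ᶻ z [ p ] → x ≋ y [ p ]
≋-cancelʳ {p} pp x y z z≉0 (≋-mk d) = [ ≋-difference , (λ e → contradiction e z≉0) ]′
  (≋-prime-factor pp (x - y) z (≋0 (subst ((+ p) Signed.∣_) (lem x y z) d)))
  where lem : ∀ x y z → x *ᶻ z - y *ᶻ z ≡ (x - y) *ᶻ z
        lem = solve-∀

product≉0 : ∀ {p} → Prime p → ∀ xs → (∀ {x} → x ∈ xs → ¬ + x ≋ 0ℤ [ p ]) → ¬ + product xs ≋ 0ℤ [ p ]
product≉0 pp []       _ e = prime⇒≉0 pp e
product≉0 {p} pp (x ∷ xs) h e
  with ≋-prime-factor pp (+ x) (+ product xs) (subst (_≋ 0ℤ [ p ]) (ℤₚ.pos-* x (product xs)) e)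
... | inj₁ f = h (here refl) f
... | inj₂ f = product≉0 pp xs (h ∘ there) f

prime∤⇒coprime : ∀ {p a} → Prime p → ¬ p ∣ a → Coprime p a
prime∤⇒coprime pp p∤a (d∣p , d∣a) with prime⇒irreducible pp d∣p
... | inj₁ d≡1  = d≡1
... | inj₂ refl = contradiction d∣a p∤a

≉0⇒coprime : ∀ {p a} → Prime p → ¬ + a ≋ 0ℤ [ p ] → Coprime p a
≉0⇒coprime pp a≉0 = prime∤⇒coprime pp λ p∣a → a≉0 (≋0 (∣ᵤ⇒∣ p∣a))

inverse-mod-prime : ∀ {p} → Prime p → ∀ z → ¬ z ≋ 0ℤ [ p ] → ∃[ w ] z *ᶻ w ≋ 1ℤ [ p ]
inverse-mod-prime {p} pp z z≉0 = let (u , e) = ≋-inverse (Cop.sym (≉0⇒coprime pp r≉0)) in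
  u , ≋-trans (≋-reflexive (ℤₚ.*-comm z u)) (≋-trans (≋-*ˡ u (≋-sym (≋-%ℕ z p))) e)
  where instance _ = prime⇒nonZero pp
        r≉0 : ¬ + (z ℤD.%ℕ p) ≋ 0ℤ [ p ]
        r≉0 e = z≉0 (≋-trans (≋-sym (≋-%ℕ z p)) e)

inverse≉0 : ∀ {p} → Prime p → ∀ z w → z *ᶻ w ≋ 1ℤ [ p ] → ¬ w ≋ 0ℤ [ p ]
inverse≉0 pp z w zw w≋0 = prime⇒≉0 pp
  (≋-trans (≋-sym zw) (≋-trans (≋-*ˡ z w≋0) (≋-reflexive (ℤₚ.*-zeroʳ z))))

∈-nonzero⁻ : ∀ {p} → Prime p → ∀ {x} → x ∈ range 1 (p ∸ 1) → x < p × ¬ + x ≋ 0ℤ [ p ]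
∈-nonzero⁻ {suc p} pp x∈ with ∈-range⁻ {1} x∈
... | 0<x , x<p = x<p , λ e → ℕₚ.<⇒≢ 0<x (sym (≋-injective x<p (s≤s z≤n) e))

∈-nonzero⁺ : ∀ {p} → Prime p → ∀ {x} → x < p → ¬ + x ≋ 0ℤ [ p ] → x ∈ range 1 (p ∸ 1)
∈-nonzero⁺ {suc p} pp {zero}  _   x≉0 = contradiction ≋-refl x≉0
∈-nonzero⁺ {suc p} pp {suc x} x<p x≉0 = ∈-range⁺ {1} (s≤s z≤n) x<p

-- Multiplication by `z` permutes the nonzero residues. It leaves their product unchanged, yet
-- multiplies it by the power of `z`; the product is then cancelled.
fermat : ∀ {p} → Prime p → ∀ z → ¬ z ≋ 0ℤ [ p ] → z ^ᶻ (p ∸ 1) ≋ 1ℤ [ p ]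
fermat {p} pp z z≉0 = ≋-cancelʳ pp (z ^ᶻ (p ∸ 1)) 1ℤ (+ product xs) (product≉0 pp xs (proj₂ ∘ ∈-nonzero⁻ pp))
  (≋-trans (≋-reflexive (cong (λ n → z ^ᶻ n *ᶻ + product xs) (sym (length-range 1 (p ∸ 1)))))
  (≋-trans (≋-sym (product-map-≋ z (scale p z) xs (λ {x} _ → scale-≋ p z x)))
  (≋-reflexive (trans (cong +_ (product-↭ perm)) (sym (ℤₚ.*-identityˡ (+ product xs)))))))
  where
  instance _ = prime⇒nonZero pp
  xs = range 1 (p ∸ 1)
  w = proj₁ (inverse-mod-prime pp z z≉0)
  zw : z *ᶻ w ≋ 1ℤ [ p ]
  zw = proj₂ (inverse-mod-prime pp z z≉0)
  closed : ∀ c → ¬ c ≋ 0ℤ [ p ] → ∀ {x} → x ∈ xs → scale p c x ∈ xs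
  closed c c≉0 {x} x∈ = ∈-nonzero⁺ pp (scale-< p c x) λ e →
    [ c≉0 , proj₂ (∈-nonzero⁻ pp x∈) ]′ (≋-prime-factor pp c (+ x) (≋-trans (≋-sym (scale-≋ p c x)) e))
  perm : map (scale p z) xs ↭ xs
  perm = scale-↭ z w zw (unique-range 1 (p ∸ 1)) (proj₁ ∘ ∈-nonzero⁻ pp) (closed z z≉0) (closed w (inverse≉0 pp z w zw))

-- Polynomials and the number of their roots

-- A vector (c₀, …, cₙ₋₁) stands for the monic polynomial c₀ + c₁ x + … + cₙ₋₁ xⁿ⁻¹ + xⁿ.
eval : ∀ {n} → Vec ℤ n → ℤ → ℤ
eval []       x = 1ℤ
eval (c ∷ cs) x = c +ᶻ x *ᶻ eval cs x

-- The scaled polynomial has degree one lower, so the sum is again monic and needs no leading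
-- coefficient.
addScaled : ∀ {n} → ℤ → Vec ℤ (suc n) → Vec ℤ n → Vec ℤ (suc n)
addScaled a (c ∷ cs) []       = (c +ᶻ a) ∷ cs
addScaled a (c ∷ cs) (d ∷ ds) = (c +ᶻ a *ᶻ d) ∷ addScaled a cs ds

eval-addScaled : ∀ {n} a (cs : Vec ℤ (suc n)) ds x → eval (addScaled a cs ds) x ≡ eval cs x +ᶻ a *ᶻ eval ds x
eval-addScaled a (c ∷ []) [] x = lem a c x
  where lem : ∀ a c x → (c +ᶻ a) +ᶻ x *ᶻ 1ℤ ≡ (c +ᶻ x *ᶻ 1ℤ) +ᶻ a *ᶻ 1ℤ
        lem = solve-∀
eval-addScaled a (c ∷ cs) (d ∷ ds) x = trans
  (cong (λ z → (c +ᶻ a *ᶻ d) +ᶻ x *ᶻ z) (eval-addScaled a cs ds x)) (lem a c d x (eval cs x) (eval ds x))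
  where lem : ∀ a c d x y z → (c +ᶻ a *ᶻ d) +ᶻ x *ᶻ (y +ᶻ a *ᶻ z) ≡ (c +ᶻ x *ᶻ y) +ᶻ a *ᶻ (d +ᶻ x *ᶻ z)
        lem = solve-∀

-- Synthetic division by `x - a`. For `c + x f(x)` with `q` the quotient of `f`, the difference of
-- the values at `x` and `a` is `(x - a) f(x) + a (f(x) - f(a))`, that is `(x - a) (f(x) + a q(x))`.
quotient : ∀ {n} → ℤ → Vec ℤ (suc n) → Vec ℤ n
quotient a (c ∷ [])          = []
quotient a (c ∷ cs@(_ ∷ _)) = addScaled a cs (quotient a cs)

eval-quotient : ∀ {n} a (cs : Vec ℤ (suc n)) x → eval cs x - eval cs a ≡ (x - a) *ᶻ eval (quotient a cs) x
eval-quotient a (c ∷ []) x = lem a c x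
  where lem : ∀ a c x → (c +ᶻ x *ᶻ 1ℤ) - (c +ᶻ a *ᶻ 1ℤ) ≡ (x - a) *ᶻ 1ℤ
        lem = solve-∀
eval-quotient a (c ∷ cs@(_ ∷ _)) x =
  trans (lem₁ a c x (eval cs x) (eval cs a))
  (trans (cong (λ z → (x - a) *ᶻ eval cs x +ᶻ a *ᶻ z) (eval-quotient a cs x))
  (trans (lem₂ (x - a) a (eval cs x) (eval (quotient a cs) x))
  (cong ((x - a) *ᶻ_) (sym (eval-addScaled a cs (quotient a cs) x)))))
  where lem₁ : ∀ a c x y z → (c +ᶻ x *ᶻ y) - (c +ᶻ a *ᶻ z) ≡ (x - a) *ᶻ y +ᶻ a *ᶻ (y - z)
        lem₁ = solve-∀
        lem₂ : ∀ b a y z → b *ᶻ y +ᶻ a *ᶻ (b *ᶻ z) ≡ b *ᶻ (y +ᶻ a *ᶻ z)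
        lem₂ = solve-∀

-- Lagrange's bound: after `x - a` is split off for one root `a`, primality of `p` makes every other
-- root a root of the quotient. In degree 0 the polynomial is the constant 1.
roots-bound : ∀ {p n} → Prime p → (cs : Vec ℤ n) → ∀ {xs} → AllPairs (λ x y → ¬ x ≋ y [ p ]) xs →
              (∀ {x} → x ∈ xs → eval cs x ≋ 0ℤ [ p ]) → length xs ≤ n
roots-bound pp cs {[]} _ _ = z≤n
roots-bound pp [] {x ∷ xs} _ root = contradiction (root (here refl)) (prime⇒≉0 pp)
roots-bound {p} pp cs@(_ ∷ _) {a ∷ xs} (a≉ ∷ u) root =
  s≤s (roots-bound pp (quotient a cs) u λ {x} x∈ →
    [ (λ e → contradiction (≋-sym (≋-difference e)) (All.lookup a≉ x∈)) , id ]′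
    (≋-prime-factor pp (x - a) (eval (quotient a cs) x)
      (≋0 (subst ((+ p) Signed.∣_) (eval-quotient a cs x)
        (diff (≋-trans (root (there x∈)) (≋-sym (root (here refl)))))))))

eval-monomial : ∀ n x → eval (replicate n 0ℤ) x ≡ x ^ᶻ n
eval-monomial zero    x = refl
eval-monomial (suc n) x = trans (ℤₚ.+-identityˡ _) (cong (x *ᶻ_) (eval-monomial n x))

unity-roots-bound : ∀ {p n xs} → Prime p → 0 < n → AllPairs (λ x y → ¬ x ≋ y [ p ]) xs →
                    (∀ {x} → x ∈ xs → x ^ᶻ n ≋ 1ℤ [ p ]) → length xs ≤ n
-- The vector encodes the polynomial that is the power of `x` with exponent `suc n`, minus 1.
unity-roots-bound {p} {suc n} {xs} pp _ u root = roots-bound pp (- 1ℤ ∷ replicate n 0ℤ) u λ {x} x∈ →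
  ≋-trans (≋-reflexive (cong (λ z → - 1ℤ +ᶻ x *ᶻ z) (eval-monomial n x)))
          (≋-+ (≋-refl {x = - 1ℤ}) (root x∈))

-- Existence of elements of given order modulo a prime

-- Otherwise all `p ∸ 1` nonzero residues would be roots of a polynomial of degree `n`. The witness
-- is found by a decidable search through them.
power-not-one : ∀ {p n} → Prime p → 0 < n → n < p ∸ 1 → ∃[ x ] (¬ + x ≋ 0ℤ [ p ] × ¬ (+ x) ^ᶻ n ≋ 1ℤ [ p ])
power-not-one {p@(suc _)} {n} pp 0<n n<p-1 with All.all? (λ x → ≋? ((+ x) ^ᶻ n) 1ℤ p) (range 1 (p ∸ 1))
... | yes all = contradiction n<p-1 (ℕₚ.≤⇒≯ (subst (_≤ n) (trans (Listₚ.length-map +_ (range 1 (p ∸ 1))) (length-range 1 (p ∸ 1)))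
        (unity-roots-bound pp 0<n incongruent root)))
  where
  incongruent : AllPairs (λ x y → ¬ x ≋ y [ p ]) (map +_ (range 1 (p ∸ 1)))
  incongruent = AllPairsₚ.map⁺ (AllPairsₚ.map⁺ (AllPairsₚ.applyUpTo⁺₁ id (p ∸ 1) λ i<j j<p-1 e →
    ℕₚ.<⇒≢ (s≤s i<j) (≋-injective (s≤s (ℕₚ.<-trans i<j j<p-1)) (s≤s j<p-1) e)))
  root : ∀ {x} → x ∈ map +_ (range 1 (p ∸ 1)) → x ^ᶻ n ≋ 1ℤ [ p ]
  root x∈ with ∈-map⁻ +_ x∈
  ... | _ , y∈ , refl = All.lookup all y∈
... | no ¬all = let (x , x∈ , x^n≉1) = find (¬All⇒Any¬ (λ x → ≋? ((+ x) ^ᶻ n) 1ℤ p) _ ¬all)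
                in x , proj₂ (∈-nonzero⁻ pp x∈) , x^n≉1

power-not-one-∣ : ∀ {p n k} → Prime p → p ∸ 1 ≡ n * k → 1 < k →
                  ∃[ x ] (¬ + x ≋ 0ℤ [ p ] × ¬ (+ x) ^ᶻ n ≋ 1ℤ [ p ])
power-not-one-∣ {p} {zero} pp eq _ = contradiction eq (ℕₚ.m>n⇒m∸n≢0 (prime⇒1< pp))
power-not-one-∣ {p} {n@(suc _)} {k} pp eq 1<k =
  power-not-one pp (s≤s z≤n) (subst (n <_) (sym eq) (ℕₚ.m<m*n n k 1<k))

-- With `p ∸ 1 ≡ k * r`, a `k`-th power is an `r`-th root of unity by Fermat, and some `k`-th power
-- differs from 1 because `k < p ∸ 1`.
nontrivial-unity-root : ∀ {p r} → Prime p → 1 < r → r ∣ p ∸ 1 → ∃[ c ] (¬ c ≋ 1ℤ [ p ] × c ^ᶻ r ≋ 1ℤ [ p ])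
nontrivial-unity-root {p} {r} pp 1<r (divides k eq) =
  let (x , x≉0 , x^k≉1) = power-not-one-∣ {n = k} {r} pp eq 1<r in
  (+ x) ^ᶻ k , x^k≉1 ,
  ≋-trans (≋-reflexive (trans (ℤₚ.^-*-assoc (+ x) k r) (cong ((+ x) ^ᶻ_) (sym eq)))) (fermat pp (+ x) x≉0)

hasOrd-prime : ∀ {m c r} → Prime r → c ^ᶻ r ≋ 1ℤ [ m ] → ¬ c ≋ 1ℤ [ m ] → HasOrd m c r
hasOrd-prime {m} {c} {r} pr e c≉1 = hasOrd e divs
  where divs : ∀ n → c ^ᶻ n ≋ 1ℤ [ m ] → r ∣ n
        divs n f with r ∣? n
        ... | yes r∣n = r∣n
        ... | no r∤n = contradiction (pow-coprime c r n (prime∤⇒coprime pr r∤n) e f) c≉1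

-- An exponent `n` of `x` is one of `x ^ᶻ r`, so `d`, and with it `r`, divides `n`. Writing `n` as
-- `k * r` makes `k` an exponent of `x ^ᶻ r`, so `d` divides `k`.
hasOrd-root : ∀ {m} x r d .{{_ : NonZero r}} → r ∣ d → HasOrd m (x ^ᶻ r) d → HasOrd m x (r * d)
hasOrd-root {m} x r d r∣d o = hasOrd (≋-trans (≋-reflexive (sym (ℤₚ.^-*-assoc x r d))) (power o)) divs
  where
  divs : ∀ n → x ^ᶻ n ≋ 1ℤ [ m ] → r * d ∣ n
  divs n e = step (∣-trans r∣d (divisor o n x^rn))
    where
    x^rn : (x ^ᶻ r) ^ᶻ n ≋ 1ℤ [ m ]
    x^rn = ≋-trans (≋-reflexive (ℤₚ.^-*-assoc x r n)) (pow-∣ x n e (n∣m*n r))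
    step : r ∣ n → r * d ∣ n
    step (divides k refl) = subst (r * d ∣_) (*-comm r k) (Div.*-monoʳ-∣ r
      (divisor o k (≋-trans (≋-reflexive (trans (ℤₚ.^-*-assoc x r k) (cong (x ^ᶻ_) (*-comm r k)))) e)))

hasOrd-prime-power : ∀ {m r} → Prime r → ∀ j c → c ^ᶻ (r ^ suc j) ≋ 1ℤ [ m ] → ¬ c ^ᶻ (r ^ j) ≋ 1ℤ [ m ] →
                     HasOrd m c (r ^ suc j)
hasOrd-prime-power {m} {r} pr zero c e c≉1 = subst (HasOrd m c) (sym (*-identityʳ r))
  (hasOrd-prime pr (subst (λ n → c ^ᶻ n ≋ 1ℤ [ m ]) (*-identityʳ r) e)
    (c≉1 ∘ ≋-trans (≋-reflexive (ℤₚ.^-identityʳ c))))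
hasOrd-prime-power {m} {r} pr (suc j) c e c≉1 = hasOrd-root c r (r ^ suc j) (m∣m*n (r ^ j))
  (hasOrd-prime-power pr j (c ^ᶻ r) (≋-trans (≋-reflexive (ℤₚ.^-*-assoc c r (r ^ suc j))) e)
    (c≉1 ∘ ≋-trans (≋-reflexive (sym (ℤₚ.^-*-assoc c r (r ^ j))))))
  where instance _ = prime⇒nonZero pr

pow-distrib : ∀ x y n → (x *ᶻ y) ^ᶻ n ≡ x ^ᶻ n *ᶻ y ^ᶻ n
pow-distrib x y zero    = refl
pow-distrib x y (suc n) = trans (cong (x *ᶻ y *ᶻ_) (pow-distrib x y n)) (lem x y (x ^ᶻ n) (y ^ᶻ n))
  where lem : ∀ x y z w → x *ᶻ y *ᶻ (z *ᶻ w) ≡ (x *ᶻ z) *ᶻ (y *ᶻ w)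
        lem = solve-∀

-- If `n` is an exponent of the product, raising to the power `b` removes `y`, so `a` divides
-- `b * n` and hence `n`; symmetrically for `b`.
hasOrd-* : ∀ {m} x y a b → Coprime a b → HasOrd m x a → HasOrd m y b → HasOrd m (x *ᶻ y) (a * b)
hasOrd-* {m} x y a b c ox oy = hasOrd
  (≋-trans (≋-reflexive (pow-distrib x y (a * b))) (≋-* {x = x ^ᶻ (a * b)} {1ℤ} {y ^ᶻ (a * b)} {1ℤ} (pow-∣ x a (power ox) (m∣m*n b)) (pow-∣ y b (power oy) (n∣m*n a))))
  (λ n e → coprime-product-∣ c (divides-left x y a b c ox oy n e)
    (divides-left y x b a (Cop.sym c) oy ox n (≋-trans (≋-^ n (≋-reflexive (ℤₚ.*-comm y x))) e)))
  where
  divides-left : ∀ x y a b → Coprime a b → HasOrd m x a → HasOrd m y b →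
                 ∀ n → (x *ᶻ y) ^ᶻ n ≋ 1ℤ [ m ] → a ∣ n
  divides-left x y a b c ox oy n e = Cop.coprime-divisor c (divisor ox (b * n)
    (≋-trans (≋-reflexive (sym (ℤₚ.*-identityʳ _)))
    (≋-trans (≋-*ˡ (x ^ᶻ (b * n)) (≋-sym (pow-∣ y b (power oy) (m∣m*n n))))
    (≋-trans (≋-reflexive (sym (pow-distrib x y (b * n)))) (pow-∣ (x *ᶻ y) n e (n∣m*n b))))))

range-sorted : ∀ lo n → AllPairs _<_ (range lo n)
range-sorted lo n = AllPairsₚ.map⁺ (AllPairsₚ.applyUpTo⁺₁ id n (λ i<j _ → ℕₚ.+-monoʳ-< lo i<j))

-- Sortedness makes the first hit the least one, and the known hit `k` keeps the search from falling
-- through to its default 0.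
firstHit-spec : ∀ f t {ks k} → AllPairs _<_ ks → k ∈ ks → f k ≡ t →
                firstHit ks f t ∈ ks × f (firstHit ks f t) ≡ t × (∀ {j} → j ∈ ks → j < firstHit ks f t → f j ≢ t)
firstHit-spec f t {k ∷ ks} (k< ∷ sorted) k′∈ e with f k ≟ t | k′∈
... | yes p | _ = here refl , p , least
  where least : ∀ {j} → j ∈ k ∷ ks → j < k → f j ≢ t
        least (here refl) j<k = contradiction j<k (ℕₚ.<-irrefl refl)
        least (there j∈)  j<k = contradiction j<k (ℕₚ.<⇒≯ (All.lookup k< j∈))
... | no ¬p | here refl = contradiction e ¬p
... | no ¬p | there k′∈′ = let (h∈ , fh , least) = firstHit-spec f t sorted k′∈′ e in
  there h∈ , fh , λ { (here refl) _ → ¬p ; (there j∈) j<h → least j∈ j<h }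

modN≡0⇒∣ : ∀ n d → modN n d ≡ 0 → d ∣ n
modN≡0⇒∣ n zero    refl = ∣-refl
modN≡0⇒∣ n (suc d) e    = Div.m%n≡0⇒n∣m n (suc d) e

∣⇒modN≡0 : ∀ n d → d ∣ n → modN n d ≡ 0
∣⇒modN≡0 n zero    d∣n = Div.0∣⇒≡0 d∣n
∣⇒modN≡0 n (suc d) d∣n = Div.n∣m⇒m%n≡0 n (suc d) d∣n

leastDiv-spec : ∀ {n} → 1 < n → leastDiv n ∣ n × Prime (leastDiv n)
leastDiv-spec {n} 1<n = r∣n , prime {{ℕ.n>1⇒nonTrivial 1<r}} noSmaller
  where
  r = leastDiv n
  spec : r ∈ range 2 n × modN n r ≡ 0 × (∀ {j} → j ∈ range 2 n → j < r → modN n j ≢ 0)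
  -- `n` itself is a hit: the searched range runs from 2 to `n + 1`.
  spec = firstHit-spec (modN n) 0 (range-sorted 2 n)
           (∈-range⁺ {2} {n} 1<n (m≤n+m (suc n) 1)) (∣⇒modN≡0 n n ∣-refl)
  r∣n = modN≡0⇒∣ n r (proj₁ (proj₂ spec))
  1<r = proj₁ (∈-range⁻ {2} {n} (proj₁ spec))
  noSmaller : ¬ r Div.HasNonTrivialDivisorLessThan r
  noSmaller (Div.hasNonTrivialDivisor {d} d<r d∣r) = proj₂ (proj₂ spec)
    (∈-range⁺ {2} {n} (ℕ.nonTrivial⇒n>1 d) (ℕₚ.<-trans d<r (proj₂ (∈-range⁻ {2} {n} (proj₁ spec)))))
    d<r (∣⇒modN≡0 n d (∣-trans d∣r r∣n))

coprime-* : ∀ {a b s} → Coprime a s → Coprime b s → Coprime (a * b) s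
coprime-* ca cb (d∣ab , d∣s) =
  cb (Cop.coprime-divisor (λ (e∣d , e∣a) → ca (e∣a , ∣-trans e∣d d∣s)) d∣ab , d∣s)

coprime-^ : ∀ {a s} k → Coprime a s → Coprime (a ^ k) s
coprime-^ {s = s} zero    c = Cop.1-coprimeTo s
coprime-^ (suc k) c = coprime-* c (coprime-^ k c)

prime-power-split : ∀ {r} → Prime r → ∀ n → 0 < n → ∃[ k ] ∃[ s ] (n ≡ r ^ k * s × ¬ r ∣ s)
prime-power-split {r} pr = <-rec (λ n → 0 < n → ∃[ k ] ∃[ s ] (n ≡ r ^ k * s × ¬ r ∣ s)) step
  where
  step : ∀ n → (∀ {i} → i < n → 0 < i → ∃[ k ] ∃[ s ] (i ≡ r ^ k * s × ¬ r ∣ s)) →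
         0 < n → ∃[ k ] ∃[ s ] (n ≡ r ^ k * s × ¬ r ∣ s)
  step n rec 0<n with r ∣? n
  ... | no r∤n = 0 , n , sym (ℕₚ.+-identityʳ n) , r∤n
  ... | yes (divides zero refl) = contradiction 0<n (λ ())
  ... | yes (divides i@(suc _) refl) =
    let (k , s , eq , r∤s) = rec (ℕₚ.m<m*n i r (prime⇒1< pr)) (s≤s z≤n)
    in suc k , s , trans (*-comm i r) (trans (cong (r *_) eq) (sym (*-assoc r (r ^ k) s))) , r∤s

-- Choose `x` whose power with exponent `k * r ^ j` is not 1, where `k` is the cofactor of
-- `r ^ suc j` in `p ∸ 1`; then `(+ x) ^ᶻ k` has the required order.
hasOrd-exists-prime-power : ∀ {p r} → Prime p → Prime r → ∀ j → r ^ suc j ∣ p ∸ 1 → ∃[ c ] HasOrd p c (r ^ suc j)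
hasOrd-exists-prime-power {p} {r} pp pr j (divides k eq) =
  let (x , x≉0 , x≉1) = power-not-one-∣ {n = k * r ^ j} {r} pp
        (trans eq (trans (cong (k *_) (*-comm r (r ^ j))) (sym (*-assoc k (r ^ j) r)))) (prime⇒1< pr)
  in (+ x) ^ᶻ k , hasOrd-prime-power pr j ((+ x) ^ᶻ k)
       (≋-trans (≋-reflexive (trans (ℤₚ.^-*-assoc (+ x) k (r ^ suc j)) (cong ((+ x) ^ᶻ_) (sym eq)))) (fermat pp (+ x) x≉0))
       (x≉1 ∘ ≋-trans (≋-reflexive (sym (ℤₚ.^-*-assoc (+ x) k (r ^ j)))))

-- The full power of the least prime factor is split off from `n`. An element of that order, times
-- one of the coprime cofactor's order obtained by induction, has order `n`.
hasOrd-exists : ∀ {p} → Prime p → ∀ n → 0 < n → n ∣ p ∸ 1 → ∃[ x ] HasOrd p x n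
hasOrd-exists {p} pp = <-rec (λ n → 0 < n → n ∣ p ∸ 1 → ∃[ x ] HasOrd p x n) step
  where
  step : ∀ n → (∀ {i} → i < n → 0 < i → i ∣ p ∸ 1 → ∃[ x ] HasOrd p x i) → 0 < n → n ∣ p ∸ 1 → ∃[ x ] HasOrd p x n
  step (suc zero) _ _ _ = 1ℤ , hasOrd ≋-refl (λ n _ → 1∣ n)
  step n@(suc (suc _)) rec 0<n n∣ with leastDiv-spec {n} (s≤s (s≤s z≤n))
  ... | r∣n , pr with prime-power-split pr n 0<n
  ... | zero , s , eq , r∤s = contradiction (subst (leastDiv n ∣_) (trans eq (ℕₚ.+-identityʳ s)) r∣n) r∤s
  ... | suc j , s , eq , r∤s =
    let (x , ox) = hasOrd-exists-prime-power pp pr j (∣-trans (divides s (trans eq (*-comm _ s))) n∣)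
        (y , oy) = rec s<n 0<s (∣-trans (divides (leastDiv n ^ suc j) eq) n∣)
    in x *ᶻ y , subst (HasOrd p (x *ᶻ y)) (sym eq)
         (hasOrd-* x y _ s (coprime-^ (suc j) (prime∤⇒coprime pr r∤s)) ox oy)
    where
    0<s : 0 < s
    0<s = ℕₚ.n≢0⇒n>0 λ { refl → r∤s (leastDiv n ∣0) }
    s<n : s < n
    s<n = subst (s <_) (trans (*-comm s _) (sym eq)) (ℕₚ.m<m*n s (leastDiv n ^ suc j) {{ℕ.>-nonZero 0<s}}
            (ℕₚ.<-≤-trans (prime⇒1< pr) (ℕₚ.m≤m*n (leastDiv n) (leastDiv n ^ j)
              {{ℕₚ.m^n≢0 (leastDiv n) j {{prime⇒nonZero pr}}}})))

-- Orders of powers and roots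

hasOrd-pow-∣ : ∀ {m} x r d .{{_ : NonZero r}} → HasOrd m x (r * d) → HasOrd m (x ^ᶻ r) d
hasOrd-pow-∣ x r d o = hasOrd (≋-trans (≋-reflexive (ℤₚ.^-*-assoc x r d)) (power o))
  λ n e → Div.*-cancelˡ-∣ r (divisor o (r * n) (≋-trans (≋-reflexive (sym (ℤₚ.^-*-assoc x r n))) e))

hasOrd-pow-coprime : ∀ {m} x r d → Coprime d r → HasOrd m x d → HasOrd m (x ^ᶻ r) d
hasOrd-pow-coprime x r d c o = hasOrd (≋-trans (≋-reflexive (ℤₚ.^-*-assoc x r d)) (pow-∣ x d (power o) (n∣m*n r)))
  λ n e → Cop.coprime-divisor c (divisor o (r * n) (≋-trans (≋-reflexive (sym (ℤₚ.^-*-assoc x r n))) e))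

-- The cases depend on whether `x ^ᶻ d` is 1. If it is not, an exponent of `x` has the form `k * d`;
-- then both `r` and `k` are exponents of `x ^ᶻ d`, which forces `r` to divide `k`.
hasOrd-root-coprime : ∀ {m} x {r} d → Prime r → HasOrd m (x ^ᶻ r) d → HasOrd m x d ⊎ HasOrd m x (r * d)
hasOrd-root-coprime {m} x {r} d pr o with ≋? (x ^ᶻ d) 1ℤ m
... | yes e = inj₁ (hasOrd e (λ n f → divisor o n (x^rn n f)))
  where
  x^rn : ∀ n → x ^ᶻ n ≋ 1ℤ [ m ] → (x ^ᶻ r) ^ᶻ n ≋ 1ℤ [ m ]
  x^rn n f = ≋-trans (≋-reflexive (ℤₚ.^-*-assoc x r n)) (pow-∣ x n f (n∣m*n r))
... | no x^d≉1 = inj₂ (hasOrd x^rd divs)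
  where
  x^rd : x ^ᶻ (r * d) ≋ 1ℤ [ m ]
  x^rd = ≋-trans (≋-reflexive (sym (ℤₚ.^-*-assoc x r d))) (power o)
  divs : ∀ n → x ^ᶻ n ≋ 1ℤ [ m ] → r * d ∣ n
  divs n f with divisor o n (≋-trans (≋-reflexive (ℤₚ.^-*-assoc x r n)) (pow-∣ x n f (n∣m*n r)))
  ... | divides k refl with r ∣? k
  ... | yes r∣k = Div.*-monoˡ-∣ d r∣k
  ... | no r∤k = contradiction (pow-coprime (x ^ᶻ d) r k (prime∤⇒coprime pr r∤k)
                   (≋-trans (≋-reflexive (trans (ℤₚ.^-*-assoc x d r) (cong (x ^ᶻ_) (*-comm d r)))) x^rd)
                   (≋-trans (≋-reflexive (trans (ℤₚ.^-*-assoc x d k) (cong (x ^ᶻ_) (*-comm d k)))) f)) x^d≉1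

-- Units modulo `p * q` and the lists of elements of order `d`

-- Modulo a common divisor of `a` and `m`, the positive power of `a` is both 0 and 1.
hasOrd⇒coprime : ∀ {m a d} → 0 < d → HasOrd m (+ a) d → Coprime a m
hasOrd⇒coprime {m} {a} {suc d} _ o {g} (g∣a , g∣m) = Div.∣1⇒≡1 (∣⇒∣ᵤ (≋0⁻¹ {x = 1ℤ}
  (≋-trans (≋-sym (≋-weaken g∣m (power o))) (≋-*ʳ ((+ a) ^ᶻ d) (≋0 {x = + a} (∣ᵤ⇒∣ g∣a))))))

-- The bound `n ≤ m` places an exponent inside the range that `ind` searches, so the result is a
-- genuine hit.
ind-hasOrd : ∀ {m a n} .{{_ : NonZero m}} → 0 < n → n ≤ m → (+ a) ^ᶻ n ≋ 1ℤ [ m ] →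
             0 < ind m a × HasOrd m (+ a) (ind m a)
ind-hasOrd {m} {a} {n} 0<n n≤m e = 0<k , hasOrd-least 0<k (from (ind m a) (proj₁ (proj₂ spec)))
    λ j 0<j j<k f → proj₂ (proj₂ spec) (∈-range⁺ {1} {m} 0<j (ℕₚ.<-trans j<k (proj₂ (∈-range⁻ {1} {m} (proj₁ spec))))) j<k (to j f)
  where
  to : ∀ j → (+ a) ^ᶻ j ≋ 1ℤ [ m ] → modN (a ^ j) m ≡ modN 1 m
  to j f = ≋⇒modN≡ m (≋-trans (≋-reflexive (pos-^ a j)) f)
  from : ∀ j → modN (a ^ j) m ≡ modN 1 m → (+ a) ^ᶻ j ≋ 1ℤ [ m ]
  from j f = ≋-trans (≋-reflexive (sym (pos-^ a j))) (modN≡⇒≋ m f)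
  spec : ind m a ∈ range 1 m × modN (a ^ ind m a) m ≡ modN 1 m ×
         (∀ {j} → j ∈ range 1 m → j < ind m a → modN (a ^ j) m ≢ modN 1 m)
  spec = firstHit-spec (λ k → modN (a ^ k) m) (modN 1 m) (range-sorted 1 m) (∈-range⁺ {1} {m} 0<n (s≤s n≤m)) (to n e)
  0<k = proj₁ (∈-range⁻ {1} {m} (proj₁ spec))

ordList : ℕ → ℕ → List ℕ
ordList m d = filter (λ a → ind m a ≟ d) (units m)

unique-units : ∀ m → Unique (units m)
unique-units m = Uniqueₚ.filter⁺ (λ a → coprime? a m) (Uniqueₚ.upTo⁺ m)

unique-ordList : ∀ m d → Unique (ordList m d)
unique-ordList m d = Uniqueₚ.filter⁺ (λ a → ind m a ≟ d) (unique-units m)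

distinct-primes-coprime : ∀ {p q} → Prime p → Prime q → p ≢ q → Coprime p q
distinct-primes-coprime pp pq p≢q = prime∤⇒coprime pp λ p∣q →
  [ (λ { refl → contradiction (prime⇒1< pp) (λ { (s≤s ()) }) }) , p≢q ]′ (prime⇒irreducible pq p∣q)

units-fermat : ∀ {p q} → Prime p → Prime q → p ≢ q → ∀ {a} → Coprime a (p * q) →
               (+ a) ^ᶻ ((p ∸ 1) * (q ∸ 1)) ≋ 1ℤ [ p * q ]
units-fermat {p} {q} pp pq p≢q {a} c = ≋-coprime-product (distinct-primes-coprime pp pq p≢q)
  (pow-∣ (+ a) (p ∸ 1) (fermat pp (+ a) (a≉0 pp (m∣m*n q))) (m∣m*n (q ∸ 1)))
  (pow-∣ (+ a) (q ∸ 1) (fermat pq (+ a) (a≉0 pq (n∣m*n p))) (n∣m*n (p ∸ 1)))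
  where
  a≉0 : ∀ {r} → Prime r → r ∣ p * q → ¬ + a ≋ 0ℤ [ r ]
  a≉0 pr r∣pq e = ℕₚ.<⇒≢ (prime⇒1< pr) (sym (c (∣⇒∣ᵤ (≋0⁻¹ e) , r∣pq)))

ind-product-hasOrd : ∀ {p q} → Prime p → Prime q → p ≢ q → ∀ {a} → Coprime a (p * q) →
                     HasOrd (p * q) (+ a) (ind (p * q) a)
ind-product-hasOrd {p} {q} pp pq p≢q c = proj₂ (ind-hasOrd {{ℕₚ.m*n≢0 p q {{prime⇒nonZero pp}} {{prime⇒nonZero pq}}}}
  (ℕₚ.*-mono-≤ (ℕₚ.m<n⇒0<n∸m (prime⇒1< pp)) (ℕₚ.m<n⇒0<n∸m (prime⇒1< pq)))
  (ℕₚ.*-mono-≤ (ℕₚ.m∸n≤m p 1) (ℕₚ.m∸n≤m q 1)) (units-fermat pp pq p≢q c))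

∈-ordList⁺ : ∀ {p q} → Prime p → Prime q → p ≢ q → ∀ {a d} → 0 < d → a < p * q → HasOrd (p * q) (+ a) d →
             a ∈ ordList (p * q) d
∈-ordList⁺ {p} {q} pp pq p≢q {a} {d} 0<d a<m o =
  ∈-filter⁺ (λ a → ind (p * q) a ≟ d) (∈-filter⁺ (λ a → coprime? a (p * q)) (∈-upTo⁺ a<m) c)
    (hasOrd-unique (ind-product-hasOrd pp pq p≢q c) o)
  where
  c : Coprime a (p * q)
  c = hasOrd⇒coprime 0<d o

∈-ordList⁻ : ∀ {p q} → Prime p → Prime q → p ≢ q → ∀ {a d} → a ∈ ordList (p * q) d →
             a < p * q × HasOrd (p * q) (+ a) d
∈-ordList⁻ {p} {q} pp pq p≢q {a} {d} a∈ =
  let (a∈u , e) = ∈-filter⁻ (λ a → ind (p * q) a ≟ d) {xs = units (p * q)} a∈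
      (a∈m , c) = ∈-filter⁻ (λ a → coprime? a (p * q)) {xs = upTo (p * q)} a∈u
  in ∈-upTo⁻ a∈m , subst (HasOrd (p * q) (+ a)) e (ind-product-hasOrd pp pq p≢q c)

-- Sums stable under a root of unity

≋-fixed⇒≋0 : ∀ {p} → Prime p → ∀ c s → ¬ c ≋ 1ℤ [ p ] → s ≋ c *ᶻ s [ p ] → s ≋ 0ℤ [ p ]
≋-fixed⇒≋0 {p} pp c s c≉1 e = [ (λ f → contradiction (≋-difference f) c≉1) , id ]′
  (≋-prime-factor pp (c - 1ℤ) s (≋0 (subst ((+ p) Signed.∣_) (lem c s) (diff (≋-sym e)))))
  where lem : ∀ c s → c *ᶻ s - s ≡ (c - 1ℤ) *ᶻ s
        lem = solve-∀

-- The list `xs` is left abstract so that one argument serves both when it holds a single order and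
-- when it joins two. Its members are characterised by `x ^ r` alone, which does not change when `x`
-- is multiplied by an `r`-th root of unity.
sum-vanishes : ∀ {p q r d} → Prime p → Prime q → p ≢ q → 1 < r → r ∣ p ∸ 1 → ∀ xs → Unique xs →
               (∀ {x} → x ∈ xs → x < p * q × HasOrd (p * q) ((+ x) ^ᶻ r) d) →
               (∀ {x} → x < p * q → HasOrd (p * q) ((+ x) ^ᶻ r) d → x ∈ xs) →
               + sum xs ≋ 0ℤ [ p ]
sum-vanishes {p} {q} {r@(suc r-1)} {d} pp pq p≢q 1<r r∣p-1 xs u ∈⇒ ⇒∈ =
  let (b , b≉1 , b^r≋1) = nontrivial-unity-root pp 1<r r∣p-1
      -- Gluing `b` with 1 modulo `q` gives an `r`-th root of unity modulo `p * q` that is still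
      -- nontrivial modulo `p`.
      (c , c≋b , c≋1) = crt (distinct-primes-coprime pp pq p≢q) b 1ℤ
      c^r≋1 = ≋-coprime-product (distinct-primes-coprime pp pq p≢q)
                (≋-trans (≋-^ r c≋b) b^r≋1) (≋-trans (≋-^ r c≋1) (≋-reflexive (ℤₚ.^-zeroˡ r)))
  in ≋-fixed⇒≋0 pp c (+ sum xs) (λ e → b≉1 (≋-trans (≋-sym c≋b) e)) (≋-weaken (m∣m*n q) (fixed c c^r≋1))
  where
  instance _ = ℕₚ.m*n≢0 p q {{prime⇒nonZero pp}} {{prime⇒nonZero pq}}
  closed : ∀ c → c ^ᶻ r ≋ 1ℤ [ p * q ] → ∀ {x} → x ∈ xs → scale (p * q) c x ∈ xs
  closed c c^r≋1 {x} x∈ = ⇒∈ (scale-< (p * q) c x) (hasOrd-≋ (≋-sym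
    (≋-trans (≋-^ r (scale-≋ (p * q) c x))
    (≋-trans (≋-reflexive (pow-distrib c (+ x) r))
    (≋-trans (≋-*ʳ ((+ x) ^ᶻ r) c^r≋1) (≋-reflexive (ℤₚ.*-identityˡ ((+ x) ^ᶻ r))))))) (proj₂ (∈⇒ x∈)))
  fixed : ∀ c → c ^ᶻ r ≋ 1ℤ [ p * q ] → + sum xs ≋ c *ᶻ + sum xs [ p * q ]
  fixed c c^r≋1 = ≋-trans (≋-reflexive (cong +_ (sym (sum-↭
    -- The inverse of `c` is its power with exponent `r-1`, which is an `r`-th root of unity too.
    (scale-↭ c (c ^ᶻ r-1) c^r≋1 u (proj₁ ∘ ∈⇒) (closed c c^r≋1)
      (closed (c ^ᶻ r-1) (≋-trans (≋-reflexive (trans (ℤₚ.^-*-assoc c r-1 r) (cong (c ^ᶻ_) (*-comm r-1 r))))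
                                  (pow-* c r r-1 c^r≋1))))))))
    (sum-map-≋ c (scale (p * q) c) xs (λ {x} _ → scale-≋ (p * q) c x))

-- Orders coprime to `p ∸ 1`

powers-incongruent : ∀ {m} y d → HasOrd m y d → ∀ {i j} → i < j → j < d → ¬ y ^ᶻ suc i ≋ y ^ᶻ suc j [ m ]
powers-incongruent {m} y d o {i} {j} i<j j<d e =
  ℕₚ.<⇒≱ (ℕₚ.≤-<-trans (ℕₚ.m∸n≤m j i) j<d) (Div.∣⇒≤ {{ℕ.>-nonZero (ℕₚ.m<n⇒0<n∸m i<j)}} (divisor o (j ∸ i) one))
  where
  -- Chosen so that `y ^ᶻ k` inverts `y ^ᶻ suc i`; the congruence then reduces to `y ^ᶻ (j ∸ i)`
  -- being 1 with `j ∸ i` positive and below `d`.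
  k = d ∸ suc i
  wy≋1 : y ^ᶻ k *ᶻ y ^ᶻ suc i ≋ 1ℤ [ m ]
  wy≋1 = ≋-trans (≋-reflexive (trans (sym (ℤₚ.^-distribˡ-+-* y k (suc i)))
           (cong (y ^ᶻ_) (ℕₚ.m∸n+n≡m (ℕₚ.<-trans i<j j<d))))) (power o)
  one : y ^ᶻ (j ∸ i) ≋ 1ℤ [ m ]
  one = ≋-trans (≋-reflexive (sym (ℤₚ.*-identityˡ (y ^ᶻ (j ∸ i)))))
    (≋-trans (≋-*ʳ (y ^ᶻ (j ∸ i)) (≋-sym wy≋1))
    (≋-trans (≋-reflexive (trans (ℤₚ.*-assoc (y ^ᶻ k) (y ^ᶻ suc i) (y ^ᶻ (j ∸ i)))
      (cong (y ^ᶻ k *ᶻ_) (trans (sym (ℤₚ.^-distribˡ-+-* y (suc i) (j ∸ i)))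
        (cong (y ^ᶻ_) (cong suc (ℕₚ.m+[n∸m]≡n (ℕₚ.<⇒≤ i<j))))))))
    (≋-trans (≋-*ˡ (y ^ᶻ k) (≋-sym e)) wy≋1)))

-- The `d` powers of `y` already exhaust the possible roots of `x ^ d - 1`; any further root would
-- exceed the bound.
unity-root-is-power : ∀ {p y d} → Prime p → 0 < d → HasOrd p y d → ∀ a → a ^ᶻ d ≋ 1ℤ [ p ] →
                      ∃[ k ] (k ∈ range 1 d × a ≋ y ^ᶻ k [ p ])
unity-root-is-power {p} {y} {d} pp 0<d o a a^d≋1 with Any.any? (λ k → ≋? a (y ^ᶻ k) p) (range 1 d)
... | yes any = find any
... | no ¬any = contradiction (unity-roots-bound pp 0<d (a≉ ∷ powers≉) root)
    (ℕₚ.<⇒≱ (s≤s (ℕₚ.≤-reflexive (sym (trans (Listₚ.length-map (y ^ᶻ_) (range 1 d)) (length-range 1 d))))))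
  where
  a≉ : All (λ x → ¬ a ≋ x [ p ]) (map (y ^ᶻ_) (range 1 d))
  a≉ = Allₚ.map⁺ (¬Any⇒All¬ (range 1 d) ¬any)
  powers≉ : AllPairs (λ x z → ¬ x ≋ z [ p ]) (map (y ^ᶻ_) (range 1 d))
  powers≉ = AllPairsₚ.map⁺ (AllPairsₚ.map⁺ (AllPairsₚ.applyUpTo⁺₁ id d (powers-incongruent y d o)))
  root : ∀ {x} → x ∈ a ∷ map (y ^ᶻ_) (range 1 d) → x ^ᶻ d ≋ 1ℤ [ p ]
  root (here refl) = a^d≋1
  root (there x∈) with ∈-map⁻ (y ^ᶻ_) x∈
  ... | k , _ , refl = ≋-trans (≋-reflexive (ℤₚ.^-*-assoc y k d)) (pow-∣ y d (power o) (n∣m*n k))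

-- If `g` divides both `k` and `d = e * g`, then `e` is already an exponent of `y ^ᶻ k`, so `e * g`
-- divides `e`.
power-hasOrd⇒coprime : ∀ {m} y k d → 0 < d → HasOrd m y d → HasOrd m (y ^ᶻ k) d → Coprime k d
power-hasOrd⇒coprime y k d 0<d o o′ {g} (divides k′ refl , divides zero refl) = contradiction 0<d (λ ())
power-hasOrd⇒coprime y k d 0<d o o′ {g} (divides k′ refl , divides e@(suc _) refl) =
  Div.∣1⇒≡1 (Div.*-cancelˡ-∣ e (subst (e * g ∣_) (sym (*-identityʳ e)) (divisor o′ e
    (≋-trans (≋-reflexive (ℤₚ.^-*-assoc y (k′ * g) e))
      (pow-∣ y (e * g) (power o) (divides k′ (trans (*-assoc k′ g e) (cong (k′ *_) (*-comm g e)))))))))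

sum-ones : ∀ {m} (f : ℕ → ℕ) xs → (∀ {x} → x ∈ xs → + f x ≋ 1ℤ [ m ]) → + sum (map f xs) ≋ + length xs [ m ]
sum-ones f []       _ = ≋-refl
sum-ones f (x ∷ xs) e = ≋-trans (≋-reflexive (ℤₚ.pos-+ (f x) _)) (≋-+ (e (here refl)) (sum-ones f xs (e ∘ there)))

sum-coprime-order : ∀ {p q d} → Prime p → Prime q → p ≢ q → 0 < d → Coprime d (p ∸ 1) → d ∣ q ∸ 1 →
                    + sumOrd (p * q) d ≋ + φ d [ p ]
sum-coprime-order {p} {q} {d} pp pq p≢q 0<d c d∣q-1 =
  ≋-trans (≋-reflexive (cong +_ (sum-↭ perm))) (sum-ones pw exps (λ {k} _ → pw≋1 k))
  where
  m = p * q
  instance _ = ℕₚ.m*n≢0 p q {{prime⇒nonZero pp}} {{prime⇒nonZero pq}}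
  p⊥q = distinct-primes-coprime pp pq p≢q
  -- `y` joins 1 modulo `p` to an element of order `d` modulo `q`, and so has order `d` modulo `m`.
  z = hasOrd-exists pq d 0<d d∣q-1
  lift = crt p⊥q 1ℤ (proj₁ z)
  y = proj₁ lift
  y≋1 : y ≋ 1ℤ [ p ]
  y≋1 = proj₁ (proj₂ lift)
  oq : HasOrd q y d
  oq = hasOrd-≋ (≋-sym (proj₂ (proj₂ lift))) (proj₂ z)
  y^k≋1 : ∀ k → y ^ᶻ k ≋ 1ℤ [ p ]
  y^k≋1 k = ≋-trans (≋-^ k y≋1) (≋-reflexive (ℤₚ.^-zeroˡ k))
  om : HasOrd m y d
  om = hasOrd (≋-coprime-product p⊥q (y^k≋1 d) (power oq)) (λ n e → divisor oq n (≋-weaken (n∣m*n p) e))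
  pw : ℕ → ℕ
  pw k = scale m (y ^ᶻ k) 1
  pw≋ : ∀ k → + pw k ≋ y ^ᶻ k [ m ]
  pw≋ k = ≋-trans (scale-≋ m (y ^ᶻ k) 1) (≋-reflexive (ℤₚ.*-identityʳ (y ^ᶻ k)))
  pw≋1 : ∀ k → + pw k ≋ 1ℤ [ p ]
  pw≋1 k = ≋-trans (≋-weaken (m∣m*n q) (pw≋ k)) (y^k≋1 k)
  exps = filter (λ k → coprime? k d) (range 1 d)
  unique-pw : Unique (map pw exps)
  unique-pw = AllPairsₚ.map⁺ (AllPairsₚ.filter⁺ (λ k → coprime? k d) (AllPairsₚ.map⁺ (AllPairsₚ.applyUpTo⁺₁ id d
    λ {i} {j} i<j j<d e → powers-incongruent y d om i<j j<d
      (≋-trans (≋-sym (pw≋ (suc i))) (≋-trans (≋-reflexive (cong +_ e)) (pw≋ (suc j)))))))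
  to : ∀ {a} → a ∈ ordList m d → a ∈ map pw exps
  to {a} a∈ = subst (_∈ map pw exps)
    (≋-injective (scale-< m (y ^ᶻ k) 1) (proj₁ oa) (≋-trans (pw≋ k) (≋-sym a≋)))
    (∈-map⁺ pw (∈-filter⁺ (λ k → coprime? k d) (proj₁ (proj₂ root))
      (power-hasOrd⇒coprime y k d 0<d om (hasOrd-≋ a≋ (proj₂ oa)))))
    where
    oa = ∈-ordList⁻ pp pq p≢q a∈
    a^d≋1 : (+ a) ^ᶻ d ≋ 1ℤ [ m ]
    a^d≋1 = power (proj₂ oa)
    root = unity-root-is-power pq 0<d oq (+ a) (≋-weaken (n∣m*n p) a^d≋1)
    k = proj₁ root
    a≉0 : ¬ + a ≋ 0ℤ [ p ]
    a≉0 e = ℕₚ.<⇒≢ (prime⇒1< pp) (sym (hasOrd⇒coprime 0<d (proj₂ oa) (∣⇒∣ᵤ (≋0⁻¹ e) , m∣m*n q)))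
    -- Modulo `p` both `d` and, by Fermat, `p ∸ 1` are exponents of `a`, and they are coprime.
    a≋1 : + a ≋ 1ℤ [ p ]
    a≋1 = pow-coprime (+ a) d (p ∸ 1) c (≋-weaken (m∣m*n q) a^d≋1) (fermat pp (+ a) a≉0)
    a≋ : + a ≋ y ^ᶻ k [ m ]
    a≋ = ≋-coprime-product p⊥q (≋-trans a≋1 (≋-sym (y^k≋1 k))) (proj₂ (proj₂ root))
  from : ∀ {a} → a ∈ map pw exps → a ∈ ordList m d
  from a∈ with ∈-map⁻ pw a∈
  ... | k , k∈ , refl = ∈-ordList⁺ pp pq p≢q 0<d (scale-< m (y ^ᶻ k) 1) (hasOrd-≋ (≋-sym (pw≋ k))
          (hasOrd-pow-coprime y k d (Cop.sym (proj₂ (∈-filter⁻ (λ k → coprime? k d) {xs = range 1 d} k∈))) om))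
  perm : ordList m d ↭ map pw exps
  perm = unique⇒↭ (unique-ordList m d) unique-pw to from

-- Totient of a product with a new prime

-- The separate bound `N` allows counting over several periods; for `N = n` the length is `φ n` by
-- definition.
coprimes : ℕ → ℕ → List ℕ
coprimes n N = filter (λ k → coprime? k n) (range 1 N)

∈-coprimes⁺ : ∀ n N {x} → 0 < x → x ≤ N → Coprime x n → x ∈ coprimes n N
∈-coprimes⁺ n N 0<x x≤N c = ∈-filter⁺ (λ k → coprime? k n) (∈-range⁺ {1} {N} 0<x (s≤s x≤N)) c

∈-coprimes⁻ : ∀ n N {x} → x ∈ coprimes n N → 0 < x × x ≤ N × Coprime x n
∈-coprimes⁻ n N x∈ =
  let (x∈r , c) = ∈-filter⁻ (λ k → coprime? k n) {xs = range 1 N} x∈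
      (0<x , x<1+N) = ∈-range⁻ {1} {N} x∈r
  in 0<x , ℕₚ.≤-pred x<1+N , c

unique-coprimes : ∀ n N → Unique (coprimes n N)
unique-coprimes n N = Uniqueₚ.filter⁺ (λ k → coprime? k n) (unique-range 1 N)

count-coprimes-periodic : ∀ n r → length (coprimes n (r * n)) ≡ r * φ n
count-coprimes-periodic n zero    = refl
count-coprimes-periodic n (suc r) = trans (↭-length perm) (trans (Listₚ.length-++ F)
  (cong (_+_ (φ n)) (trans (Listₚ.length-map (_+_ n) G) (count-coprimes-periodic n r))))
  where
  F = coprimes n n
  G = coprimes n (r * n)
  disjoint : ∀ {x} → ¬ (x ∈ F × x ∈ map (_+_ n) G)
  disjoint (x∈F , x∈G) with ∈-map⁻ (_+_ n) x∈G
  ... | y , y∈ , refl = ℕₚ.<⇒≱ (ℕₚ.m<m+n n (proj₁ (∈-coprimes⁻ n (r * n) y∈))) (proj₁ (proj₂ (∈-coprimes⁻ n n x∈F)))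
  to : ∀ {x} → x ∈ coprimes n (suc r * n) → x ∈ F ++ map (_+_ n) G
  to {x} x∈ with ∈-coprimes⁻ n (suc r * n) x∈ | x ℕ.≤? n
  ... | 0<x , x≤ , c | yes x≤n = ∈-++⁺ˡ (∈-coprimes⁺ n n 0<x x≤n c)
  ... | 0<x , x≤ , c | no x≰n = ∈-++⁺ʳ F (subst (_∈ map (_+_ n) G) eq (∈-map⁺ (_+_ n) (∈-coprimes⁺ n (r * n)
      (ℕₚ.m<n⇒0<n∸m (ℕₚ.≰⇒> x≰n)) (ℕₚ.m≤n+o⇒m∸n≤o x n x≤)
      (λ (d∣x∸n , d∣n) → c (subst (_ ∣_) eq (Div.∣m∣n⇒∣m+n d∣n d∣x∸n) , d∣n)))))
    where eq = ℕₚ.m+[n∸m]≡n (ℕₚ.<⇒≤ (ℕₚ.≰⇒> x≰n))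
  from : ∀ {x} → x ∈ F ++ map (_+_ n) G → x ∈ coprimes n (suc r * n)
  from {x} x∈ with ∈-++⁻ F x∈
  ... | inj₁ x∈F = let (0<x , x≤n , c) = ∈-coprimes⁻ n n x∈F in ∈-coprimes⁺ n (suc r * n) 0<x (≤-trans x≤n (m≤m+n n (r * n))) c
  ... | inj₂ x∈G with ∈-map⁻ (_+_ n) x∈G
  ... | y , y∈ , refl = let (0<y , y≤ , c) = ∈-coprimes⁻ n (r * n) y∈ in
    ∈-coprimes⁺ n (suc r * n) (≤-trans 0<y (m≤n+m y n)) (ℕₚ.+-monoʳ-≤ n y≤) (Cop.coprime-+ c)
  perm : coprimes n (suc r * n) ↭ F ++ map (_+_ n) G
  perm = unique⇒↭ (unique-coprimes n (suc r * n)) (Uniqueₚ.++⁺ (unique-coprimes n n)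
    (Uniqueₚ.map⁺ (ℕₚ.+-cancelˡ-≡ n _ _) (unique-coprimes n (r * n))) disjoint) to from

-- The numbers up to `r * n` prime to `n` are counted twice. Periodicity gives `r * φ n`. Splitting
-- by divisibility by `r` gives `φ (r * n)` from the non-multiples and `φ n` from the multiples.
φ-prime-* : ∀ {r n} → Prime r → ¬ r ∣ n → φ (r * n) ≡ (r ∸ 1) * φ n
φ-prime-* {r} {n} pr r∤n = ℕₚ.+-cancelʳ-≡ (φ n) _ _ (trans
  (trans (trans (cong (_+_ (φ (r * n))) (sym (Listₚ.length-map (r *_) F))) (sym (Listₚ.length-++ G))) (↭-length perm))
  (trans (count-coprimes-periodic n r) (trans (cong (_* φ n) (sym (ℕₚ.m∸n+n≡m (ℕₚ.<⇒≤ (prime⇒1< pr)))))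
    (trans (ℕₚ.*-distribʳ-+ (φ n) (r ∸ 1) 1) (cong (_+_ ((r ∸ 1) * φ n)) (ℕₚ.*-identityˡ (φ n)))))))
  where
  instance _ = prime⇒nonZero pr
  F = coprimes n n
  G = coprimes (r * n) (r * n)
  H = coprimes n (r * n)
  disjoint : ∀ {x} → ¬ (x ∈ G × x ∈ map (r *_) F)
  disjoint (x∈G , x∈F) with ∈-map⁻ (r *_) x∈F
  ... | y , _ , refl = ℕₚ.<⇒≢ (prime⇒1< pr) (sym (proj₂ (proj₂ (∈-coprimes⁻ (r * n) (r * n) x∈G)) (m∣m*n y , m∣m*n n)))
  to : ∀ {x} → x ∈ G ++ map (r *_) F → x ∈ H
  to x∈ with ∈-++⁻ G x∈
  ... | inj₁ x∈G = let (0<x , x≤ , c) = ∈-coprimes⁻ (r * n) (r * n) x∈G in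
    ∈-coprimes⁺ n (r * n) 0<x x≤ (λ (d∣x , d∣n) → c (d∣x , ∣-trans d∣n (n∣m*n r)))
  ... | inj₂ x∈F with ∈-map⁻ (r *_) x∈F
  ... | y , y∈ , refl = let (0<y , y≤ , c) = ∈-coprimes⁻ n n y∈ in
    ∈-coprimes⁺ n (r * n) (≤-trans 0<y (ℕₚ.m≤n*m y r)) (ℕₚ.*-monoʳ-≤ r y≤) (coprime-* (prime∤⇒coprime pr r∤n) c)
  from : ∀ {x} → x ∈ H → x ∈ G ++ map (r *_) F
  from {x} x∈ with ∈-coprimes⁻ n (r * n) x∈ | r ∣? x
  ... | 0<x , x≤ , c | no r∤x = ∈-++⁺ˡ (∈-coprimes⁺ (r * n) (r * n) 0<x x≤ (Cop.sym (coprime-* (prime∤⇒coprime pr r∤x) (Cop.sym c))))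
  ... | 0<x , x≤ , c | yes (divides zero refl) = contradiction 0<x (λ ())
  ... | 0<x , x≤ , c | yes (divides j@(suc _) refl) = ∈-++⁺ʳ G (subst (_∈ map (r *_) F) (*-comm r j)
    (∈-map⁺ (r *_) (∈-coprimes⁺ n n (s≤s z≤n) (ℕₚ.*-cancelˡ-≤ r (subst (_≤ r * n) (*-comm j r) x≤))
      (λ (d∣j , d∣n) → c (∣-trans d∣j (m∣m*n r) , d∣n)))))
  perm : G ++ map (r *_) F ↭ H
  perm = unique⇒↭ (Uniqueₚ.++⁺ (unique-coprimes (r * n) (r * n))
    (Uniqueₚ.map⁺ (ℕₚ.*-cancelˡ-≡ _ _ r) (unique-coprimes n n)) disjoint) (unique-coprimes n (r * n)) to from

-- The Möbius function

-- Each step divides by a prime, so the argument drops by at least 1 and stays within the remaining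
-- fuel.
μ-fuel-irrelevant : ∀ f f′ n → 0 < n → n ≤ f → n ≤ f′ → μ-fuel f n ≡ μ-fuel f′ n
μ-fuel-irrelevant zero    _        (suc _) _ () _
μ-fuel-irrelevant (suc f) zero     (suc _) _ _ ()
μ-fuel-irrelevant (suc f) (suc f′) n 0<n n≤f n≤f′ with n ≟ 1
... | yes _ = refl
... | no n≢1 with leastDiv n | leastDiv-spec {n} (ℕₚ.≤∧≢⇒< 0<n (n≢1 ∘ sym))
... | zero  | _ = refl
... | suc d | r∣n , pr with (suc d * suc d) ∣? n
... | yes _ = refl
... | no _ = cong -_ (μ-fuel-irrelevant f f′ (n / suc d)
  (DM.m≥n⇒m/n>0 (Div.∣⇒≤ {{ℕ.>-nonZero 0<n}} r∣n))
  (ℕₚ.≤-pred (<-≤-trans n/r<n n≤f)) (ℕₚ.≤-pred (<-≤-trans n/r<n n≤f′)))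
  where
  n/r<n : n / suc d < n
  n/r<n = DM.m/n<m n (suc d) {{ℕ.>-nonZero 0<n}} (prime⇒1< pr)

μ-square : ∀ {n} → 1 < n → leastDiv n * leastDiv n ∣ n → μ n ≡ 0ℤ
μ-square {n@(suc _)} 1<n rr∣n with n ≟ 1
... | yes n≡1 = contradiction (sym n≡1) (ℕₚ.<⇒≢ 1<n)
... | no _ with leastDiv n
... | zero  = refl
... | suc d with (suc d * suc d) ∣? n
... | yes _ = refl
... | no ∤n = contradiction rr∣n ∤n

μ-prime-* : ∀ {n k} → 1 < n → n ≡ leastDiv n * k → ¬ leastDiv n ∣ k → μ n ≡ - μ k
μ-prime-* {n@(suc f)} {k} 1<n eq r∤k with n ≟ 1
... | yes n≡1 = contradiction (sym n≡1) (ℕₚ.<⇒≢ 1<n)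
... | no _ with leastDiv n | leastDiv-spec {n} 1<n
... | zero  | _ , pr = contradiction (prime⇒1< pr) (λ ())
... | suc d | _ , pr with (suc d * suc d) ∣? n
... | yes rr∣n = contradiction (Div.*-cancelˡ-∣ (suc d) (subst (suc d * suc d ∣_) eq rr∣n)) r∤k
-- The recursive call has fuel `f`, one less than `n`, whereas `μ k` starts with fuel `k`.
... | no _ = cong -_ (trans (cong (μ-fuel f) n/r≡k) (μ-fuel-irrelevant f k k 0<k k≤f ≤-refl))
  where
  n/r≡k : n / suc d ≡ k
  n/r≡k = trans (cong (_/ suc d) (trans eq (*-comm (suc d) k))) (DM.m*n/n≡m k (suc d))
  0<k : 0 < k
  0<k = ℕₚ.n≢0⇒n>0 λ { refl → r∤k (suc d ∣0) }
  k≤f : k ≤ f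
  k≤f = ℕₚ.≤-pred (subst (k <_) (trans (*-comm k (suc d)) (sym eq)) (ℕₚ.m<m*n k (suc d) {{ℕ.>-nonZero 0<k}} (prime⇒1< pr)))

-- Recursion for the right-hand side

I≢1 : ∀ {n} → n ≢ 1 → I n ≡ 0
I≢1 {zero}        _   = refl
I≢1 {suc zero}    n≢1 = contradiction refl n≢1
I≢1 {suc (suc _)} _   = refl

-- The case `n = 0` holds by the convention that `_div_` sends a zero divisor to 0.
div-cancelˡ : ∀ c .{{_ : NonZero c}} m n → (c * m) div (c * n) ≡ m div n
div-cancelˡ c m zero = cong ((c * m) div_) (ℕₚ.*-zeroʳ c)
div-cancelˡ c@(suc _) m n@(suc _) = DM.m*n/m*o≡n/o c m n

*-div-cancelʳ : ∀ m n .{{_ : NonZero n}} → (m * n) div n ≡ m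
*-div-cancelʳ m n@(suc _) = DM.m*n/n≡m m n

-- The right-hand side of the congruence, with g in the role of (δ, P) and P in that of p − 1.
rhs : ℕ → ℕ → ℕ → ℤ
rhs P δ g = μ g *ᶻ + (I (gcd (δ div g) P) * (φ δ div φ g))

rhs-coprime : ∀ P δ → gcd δ P ≡ 1 → rhs P δ (gcd δ P) ≡ + φ δ
rhs-coprime P δ g≡1 = trans (cong (rhs P δ) g≡1) (trans (ℤₚ.*-identityˡ _) (cong +_
  (trans (cong₂ _*_ (cong I (trans (cong (λ n → gcd n P) (DM.n/1≡n δ)) g≡1)) (DM.n/1≡n (φ δ))) (ℕₚ.*-identityˡ (φ δ)))))

-- If the square of the prime divides the gcd, `μ` vanishes. Otherwise the prime survives in
-- `δ div g`; as it also divides `P`, the argument of `I` is not 1.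
rhs-repeated-prime : ∀ {P d δ} → 1 < gcd δ P → δ ≡ leastDiv (gcd δ P) * d → leastDiv (gcd δ P) ∣ d →
                     rhs P δ (gcd δ P) ≡ 0ℤ
rhs-repeated-prime {P} {d} {δ} 1<g δ≡ r∣d = go
  where
  g = gcd δ P
  r = leastDiv g
  r∣g = proj₁ (leastDiv-spec {g} 1<g)
  pr = proj₂ (leastDiv-spec {g} 1<g)
  instance _ = prime⇒nonZero pr
  instance _ = ℕ.>-nonZero {g} (ℕₚ.<-trans (s≤s z≤n) 1<g)
  r∣δ/g : ¬ r * r ∣ g → r ∣ δ div g
  r∣δ/g ∤g with GCD.gcd[m,n]∣m δ P | r∣g
  -- Here `e` is `δ div g` and `d` equals `e * k`; since `r` divides `d` but not `k`, it divides
  -- `e`.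
  ... | divides e δ≡eg | divides k g≡kr = subst (r ∣_) (sym (trans (cong (_div g) δ≡eg) (*-div-cancelʳ e g)))
    ([ id , (λ r∣k → contradiction (subst (r * r ∣_) (sym g≡kr) (Div.*-monoˡ-∣ r r∣k)) ∤g) ]′
      (euclidsLemma e k pr (subst (r ∣_) d≡ek r∣d)))
    where
    d≡ek : d ≡ e * k
    d≡ek = ℕₚ.*-cancelʳ-≡ d (e * k) r (trans (*-comm d r) (trans (sym δ≡)
      (trans δ≡eg (trans (cong (e *_) g≡kr) (sym (*-assoc e k r))))))
  go : rhs P δ g ≡ 0ℤ
  go with r * r ∣? g
  ... | yes rr∣g = cong (_*ᶻ + (I (gcd (δ div g) P) * (φ δ div φ g))) (μ-square 1<g rr∣g)
  ... | no rr∤g = trans (cong (λ i → μ g *ᶻ + (i * (φ δ div φ g))) (I≢1 λ e → ℕₚ.<⇒≢ (prime⇒1< pr)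
      (sym (Div.∣1⇒≡1 (subst (r ∣_) e (GCD.gcd-greatest (r∣δ/g rr∤g) (∣-trans r∣g (GCD.gcd[m,n]∣n δ P))))))))
    (ℤₚ.*-zeroʳ (μ g))

-- With `P` equal to `t * r`, the factor `r` comes out and leaves `gcd d t`, which equals `gcd d P`
-- because `r` does not divide `d`.
gcd-prime-* : ∀ {r P d} → Prime r → r ∣ P → ¬ r ∣ d → gcd (r * d) P ≡ r * gcd d P
gcd-prime-* {r} {P} {d} pr (divides t refl) r∤d = trans (cong (gcd (r * d)) (*-comm t r))
  (trans (sym (GCD.c*gcd[m,n]≡gcd[cm,cn] r d t)) (cong (r *_) (∣-antisym
    (GCD.gcd-greatest (GCD.gcd[m,n]∣m d t) (∣-trans (GCD.gcd[m,n]∣n d t) (m∣m*n r)))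
    (GCD.gcd-greatest (GCD.gcd[m,n]∣m d (t * r)) (Cop.coprime-divisor
      (Cop.sym (prime∤⇒coprime pr (λ r∣g → r∤d (∣-trans r∣g (GCD.gcd[m,n]∣m d (t * r))))))
      (subst (gcd d (t * r) ∣_) (*-comm t r) (GCD.gcd[m,n]∣n d (t * r))))))))

-- Both `δ` and the gcd lose exactly one factor `r`: their quotient is unchanged, `r ∸ 1` cancels
-- between the totients, and `μ` changes sign.
rhs-new-prime : ∀ {P d δ} → 1 < gcd δ P → δ ≡ leastDiv (gcd δ P) * d → ¬ leastDiv (gcd δ P) ∣ d →
                rhs P δ (gcd δ P) ≡ - rhs P d (gcd d P)
rhs-new-prime {P} {d} {δ} 1<g δ≡ r∤d = trans
  (cong₂ _*ᶻ_ (μ-prime-* 1<g g≡ r∤g′)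
    (cong +_ (cong₂ _*_ (cong (λ n → I (gcd n P)) (trans (cong₂ _div_ δ≡ g≡) (div-cancelˡ r d g′)))
                        (trans (cong₂ _div_ (trans (cong φ δ≡) (φ-prime-* pr r∤d)) (trans (cong φ g≡) (φ-prime-* pr r∤g′)))
                               (div-cancelˡ (r ∸ 1) (φ d) (φ g′))))))
  (sym (ℤₚ.neg-distribˡ-* (μ g′) (+ (I (gcd (d div g′) P) * (φ d div φ g′)))))
  where
  g = gcd δ P
  g′ = gcd d P
  r = leastDiv g
  pr = proj₂ (leastDiv-spec {g} 1<g)
  instance _ = prime⇒nonZero pr
  instance _ = ℕ.>-nonZero (ℕₚ.m<n⇒0<n∸m (prime⇒1< pr))
  g≡ : g ≡ r * g′
  g≡ = trans (cong (λ n → gcd n P) δ≡) (gcd-prime-* pr (∣-trans (proj₁ (leastDiv-spec {g} 1<g)) (GCD.gcd[m,n]∣n δ P)) r∤d)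
  r∤g′ : ¬ r ∣ g′
  r∤g′ r∣g′ = r∤d (∣-trans r∣g′ (GCD.gcd[m,n]∣m d P))

-- The induction on the order

-- The remainder of `(p ∸ 1) * (q ∸ 1)` modulo `L` is again an exponent for all units, so minimality
-- of `L` makes it zero.
carmichael-∣ : ∀ {p q L} → Prime p → Prime q → p ≢ q → IsCarmichael (p * q) L → L ∣ (p ∸ 1) * (q ∸ 1)
carmichael-∣ {p} {q} {L@(suc _)} pp pq p≢q (_ , L-pow , least) = Div.m%n≡0⇒n∣m N L (rem-zero (N % L) (DM.m%n<n N L) rem-pow)
  where
  instance _ = ℕₚ.m*n≢0 p q {{prime⇒nonZero pp}} {{prime⇒nonZero pq}}
  N = (p ∸ 1) * (q ∸ 1)
  m = p * q
  rem-pow : AllUnitsPow1 m (N % L)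
  rem-pow a a<m c = ≋⇒modN≡ m (≋-trans (≋-reflexive (pos-^ a (N % L)))
    (pow-cancel (+ a) (N / L * L) (N % L)
      (≋-trans (≋-reflexive (cong ((+ a) ^ᶻ_) (trans (+-comm (N / L * L) (N % L)) (sym (DM.m≡m%n+[m/n]*n N L)))))
               (units-fermat pp pq p≢q c))
      (pow-∣ (+ a) L (≋-trans (≋-reflexive (sym (pos-^ a L))) (modN≡⇒≋ m (L-pow a a<m c))) (n∣m*n (N / L)))))
  rem-zero : ∀ k → k < L → AllUnitsPow1 m k → k ≡ 0
  rem-zero zero    _   _ = refl
  rem-zero (suc k) k<L u = contradiction u (least (suc k) (s≤s z≤n) k<L)

sumOrd-repeated-prime : ∀ {p q r d} → Prime p → Prime q → p ≢ q → Prime r → r ∣ p ∸ 1 → r ∣ d → 0 < r * d →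
                        + sumOrd (p * q) (r * d) ≋ 0ℤ [ p ]
sumOrd-repeated-prime {p} {q} {r} {d} pp pq p≢q pr r∣p-1 r∣d 0<rd =
  sum-vanishes pp pq p≢q (prime⇒1< pr) r∣p-1 (ordList (p * q) (r * d)) (unique-ordList (p * q) (r * d))
    (λ {x} x∈ → let (x<m , o) = ∈-ordList⁻ pp pq p≢q x∈ in x<m , hasOrd-pow-∣ (+ x) r d o)
    (λ {x} x<m o → ∈-ordList⁺ pp pq p≢q 0<rd x<m (hasOrd-root (+ x) r d r∣d o))
  where instance _ = prime⇒nonZero pr

sumOrd-new-prime : ∀ {p q r d} → Prime p → Prime q → p ≢ q → Prime r → r ∣ p ∸ 1 → ¬ r ∣ d → 0 < d →
                   + sumOrd (p * q) (r * d) +ᶻ + sumOrd (p * q) d ≋ 0ℤ [ p ]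
sumOrd-new-prime {p} {q} {r} {d} pp pq p≢q pr r∣p-1 r∤d 0<d =
  ≋-trans (≋-reflexive (trans (sym (ℤₚ.pos-+ (sum A) (sum B))) (cong +_ (sym (sum-++ A B)))))
    (sum-vanishes pp pq p≢q (prime⇒1< pr) r∣p-1 (A ++ B)
      (Uniqueₚ.++⁺ (unique-ordList m (r * d)) (unique-ordList m d) disjoint) to from)
  where
  m = p * q
  instance _ = prime⇒nonZero pr
  A = ordList m (r * d)
  B = ordList m d
  disjoint : ∀ {x} → ¬ (x ∈ A × x ∈ B)
  disjoint (x∈A , x∈B) = ℕₚ.<⇒≢ (ℕₚ.m<m*n d r {{ℕ.>-nonZero 0<d}} (prime⇒1< pr)) (trans
    (hasOrd-unique (proj₂ (∈-ordList⁻ pp pq p≢q x∈B)) (proj₂ (∈-ordList⁻ pp pq p≢q x∈A))) (*-comm r d))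
  to : ∀ {x} → x ∈ A ++ B → x < m × HasOrd m ((+ x) ^ᶻ r) d
  to {x} x∈ = [ (λ x∈A → let (x<m , o) = ∈-ordList⁻ pp pq p≢q x∈A in x<m , hasOrd-pow-∣ (+ x) r d o)
              , (λ x∈B → let (x<m , o) = ∈-ordList⁻ pp pq p≢q x∈B in
                  x<m , hasOrd-pow-coprime (+ x) r d (Cop.sym (prime∤⇒coprime pr r∤d)) o) ]′ (∈-++⁻ A x∈)
  from : ∀ {x} → x < m → HasOrd m ((+ x) ^ᶻ r) d → x ∈ A ++ B
  from {x} x<m o = [ (λ o′ → ∈-++⁺ʳ A (∈-ordList⁺ pp pq p≢q 0<d x<m o′))
                   , (λ o′ → ∈-++⁺ˡ (∈-ordList⁺ pp pq p≢q (ℕₚ.*-mono-≤ (ℕₚ.<⇒≤ (prime⇒1< pr)) 0<d) x<m o′)) ]′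
                   (hasOrd-root-coprime (+ x) d pr o)

sumOrd≋rhs : ∀ {p q} → Prime p → Prime q → p ≢ q → ∀ δ → 0 < δ → δ ∣ (p ∸ 1) * (q ∸ 1) →
             + sumOrd (p * q) δ ≋ rhs (p ∸ 1) δ (gcd δ (p ∸ 1)) [ p ]
sumOrd≋rhs {p} {q} pp pq p≢q = <-rec (λ δ → 0 < δ → δ ∣ (p ∸ 1) * (q ∸ 1) → Goal δ) step
  where
  P = p ∸ 1
  Goal : ℕ → Set
  Goal δ = + sumOrd (p * q) δ ≋ rhs P δ (gcd δ P) [ p ]
  step : ∀ δ → (∀ {d} → d < δ → 0 < d → d ∣ P * (q ∸ 1) → Goal d) → 0 < δ → δ ∣ P * (q ∸ 1) → Goal δ
  step δ rec 0<δ δ∣ with gcd δ P ≟ 1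
  -- As `δ` is prime to `P` and divides `P * (q ∸ 1)`, it divides `q ∸ 1`.
  ... | yes g≡1 = ≋-trans (sum-coprime-order pp pq p≢q 0<δ c (Cop.coprime-divisor c δ∣)) (≋-reflexive (sym (rhs-coprime P δ g≡1)))
    where c = Cop.gcd≡1⇒coprime g≡1
  ... | no g≢1 = go r∣δ
    where
    1<g : 1 < gcd δ P
    1<g = ℕₚ.≤∧≢⇒< (ℕₚ.n≢0⇒n>0 λ g≡0 → ℕₚ.<⇒≢ 0<δ (sym (GCD.gcd[m,n]≡0⇒m≡0 g≡0))) (g≢1 ∘ sym)
    r = leastDiv (gcd δ P)
    pr = proj₂ (leastDiv-spec {gcd δ P} 1<g)
    r∣P = ∣-trans (proj₁ (leastDiv-spec {gcd δ P} 1<g)) (GCD.gcd[m,n]∣n δ P)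
    r∣δ = ∣-trans (proj₁ (leastDiv-spec {gcd δ P} 1<g)) (GCD.gcd[m,n]∣m δ P)
    go : r ∣ δ → Goal δ
    go (divides d δ≡dr) with r ∣? d
    ... | yes r∣d = ≋-trans (≋-reflexive (cong (λ n → + sumOrd (p * q) n) δ≡rd))
          (≋-trans (sumOrd-repeated-prime pp pq p≢q pr r∣P r∣d (subst (0 <_) δ≡rd 0<δ))
            (≋-reflexive (sym (rhs-repeated-prime 1<g δ≡rd r∣d))))
      where δ≡rd = trans δ≡dr (*-comm d r)
    ... | no r∤d = ≋-trans (≋-reflexive (cong (λ n → + sumOrd (p * q) n) δ≡rd))
          -- The sum for `d` is added and subtracted: the joint sum vanishes modulo `p`, and the
          -- induction hypothesis evaluates the subtracted term.
          (≋-trans (≋-reflexive (lem (+ sumOrd (p * q) (r * d)) (+ sumOrd (p * q) d)))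
          (≋-trans (≋-+ (sumOrd-new-prime pp pq p≢q pr r∣P r∤d 0<d) (≋-*ˡ (- 1ℤ) ih))
            (≋-reflexive (trans (lem′ (rhs P d (gcd d P))) (sym (rhs-new-prime 1<g δ≡rd r∤d))))))
      where
      δ≡rd = trans δ≡dr (*-comm d r)
      0<d : 0 < d
      0<d = ℕₚ.n≢0⇒n>0 λ { refl → r∤d (r ∣0) }
      d<δ : d < δ
      d<δ = subst (d <_) (sym δ≡dr) (ℕₚ.m<m*n d r {{ℕ.>-nonZero 0<d}} (prime⇒1< pr))
      ih : Goal d
      ih = rec d<δ 0<d (∣-trans (divides r δ≡rd) δ∣)
      lem : ∀ x y → x ≡ (x +ᶻ y) +ᶻ - 1ℤ *ᶻ y
      lem = solve-∀
      lem′ : ∀ x → 0ℤ +ᶻ - 1ℤ *ᶻ x ≡ - x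
      lem′ = solve-∀

theorem1p9 : (p q : ℕ) → Prime p → Prime q → p % 2 ≡ 1 → q % 2 ≡ 1 → p ≢ q →
    (L : ℕ) → IsCarmichael (p * q) L →
    (δ : ℕ) → 0 < δ → δ ∣ L →
    (+ p) ∣ℤ ((+ sumOrd (p * q) δ)
    - (μ (gcd δ (p ∸ 1))
    ℤ.* (+ (I (gcd (δ div gcd δ (p ∸ 1)) (p ∸ 1))
    * (φ δ div φ (gcd δ (p ∸ 1)))))))
theorem1p9 p q pp pq _ _ p≢q L carmichael δ 0<δ δ∣L =
  ∣⇒∣ᵤ (diff (sumOrd≋rhs pp pq p≢q δ 0<δ (∣-trans δ∣L (carmichael-∣ pp pq p≢q carmichael))))
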